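{- The derivability problems of $\mathbf{RJ}$ and $\mathbf{RC}$ (given $A,B$, decide whether $A\vdash B$ is provable) are decidable in time bounded by a polynomial in the length $|A|+|B|$ of the sequent, of degree three for $\mathbf{RJ}$ and degree four for $\mathbf{RC}$. More precisely, $A\vdash_{\mathbf{RC}}B$ is decidable in $O(|A|^2\cdot n\cdot|B|)$ steps with $n=|\ell(\{A,B\})|$, and $A\vdash_{\mathbf{RJ}}B$ in $O(|A|^2\cdot|B|)$ steps, on random access machines in which every symbol (variable or modality) has unit size and elementary operations on symbols cost constant time.
   Context: Strictly positive formulas: $A::= p\mid \top\mid (A\land B)\mid \alpha A$, $\alpha\le\omega$; $\ell(X)$ is the set of modalities occurring in formulas of $X$; $|A|$ is the length of $A$. $\mathbf{RJ}$: $A\vdash A$; $A\vdash\top$; cut; $A\land B\vdash A$; $A\land B\vdash B$; from $A\vdash B$, $A\vdash C$ infer $A\vdash B\land C$; from $A\vdash B$ infer $\alpha A\vdash\alpha B$; $\alpha\alpha A\vdash\alpha A$; $\alpha\beta A\vdash\beta A$, $\beta\alpha A\vdash\beta A$ for $\alpha\ge\beta$; $\alpha A\land\beta B\vdash\alpha(A\land\beta B)$ for $\alpha>\beta$. $\mathbf{RC}=\mathbf{RJ}+\{\alpha A\vdash\beta A:\alpha>\beta\}$.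
   Formalization: In the bound O(|A|²·n·|B|) for RC, n is taken as max(|ℓ({A,B})|, 1), since for sequents without modalities (e.g. ⊤ ⊢ ⊤) n = 0 and the literal bound would allow zero steps. -}

module Defs where

open import Data.Bool.Base using (Bool; true; false; if_then_else_)
open import Data.List.Base using (List; []; _∷_; _++_; [_]; length; concatMap; deduplicate; drop; head)
open import Data.Maybe.Base using (Maybe; just; maybe′)
open import Data.Nat.Base as ℕ using (ℕ; suc; _+_; _*_; _∸_; _⊔_; _≤_; _≡ᵇ_; _<ᵇ_)
import Data.Nat.Properties as ℕ
open import Data.Product.Base using (∃-syntax; _×_)
open import Data.Sum.Base using (_⊎_; inj₁; inj₂)
open import Level using (0ℓ)
open import Relation.Binary.Construct.Never using (Never)
import Relation.Binary.Construct.Add.Supremum.NonStrict as NonStrict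
import Relation.Binary.Construct.Add.Supremum.Strict as Strict
open import Relation.Binary.Core using (Rel)
open import Relation.Binary.Definitions using (DecidableEquality; Decidable)
open import Relation.Binary.PropositionalEquality.Core using (_≡_)
open import Relation.Nullary.Construct.Add.Supremum using (_⁺; ≡-dec)
open import Relation.Nullary.Decidable.Core using (does)
open import Relation.Nullary.Reflects using (Reflects)

-- The ordinals α ≤ ω: the natural numbers with ω = ⊤⁺ on top.
Modality : Set
Modality = ℕ ⁺

open NonStrict ℕ._≤_ public using () renaming (_≤⁺_ to _≤ᵐ_)
open Strict ℕ._<_ public using () renaming (_<⁺_ to _<ᵐ_)

_≟ᵐ_ : DecidableEquality Modality
_≟ᵐ_ = ≡-dec ℕ._≟_

_<ᵐ?_ : Decidable _<ᵐ_
_<ᵐ?_ = Strict.<⁺-dec ℕ._<_ ℕ._<?_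

infixr 7 _∧_
infixr 8 ⟨_⟩_

data Formula : Set where
  var  : ℕ → Formula
  ⊤    : Formula
  _∧_  : Formula → Formula → Formula
  ⟨_⟩_ : Modality → Formula → Formula

modalities : Formula → List Modality
modalities (var _)   = []
modalities ⊤         = []
modalities (A ∧ B)   = modalities A ++ modalities B
modalities (⟨ α ⟩ A) = α ∷ modalities A

-- ℓ(X) as a list without repetitions, so that its length is the cardinality.
ℓ : List Formula → List Modality
ℓ X = deduplicate _≟ᵐ_ (concatMap modalities X)

-- RJ+ Ax is RJ extended by the sequents in Ax as additional axioms.
data RJ+ (Ax : Rel Formula 0ℓ) : Rel Formula 0ℓ where
  axiom  : ∀ {A B} → Ax A B → RJ+ Ax A B
  id     : ∀ {A} → RJ+ Ax A A
  top    : ∀ {A} → RJ+ Ax A ⊤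
  cut    : ∀ {A B C} → RJ+ Ax A B → RJ+ Ax B C → RJ+ Ax A C
  ∧-l    : ∀ {A B} → RJ+ Ax (A ∧ B) A
  ∧-r    : ∀ {A B} → RJ+ Ax (A ∧ B) B
  ∧-i    : ∀ {A B C} → RJ+ Ax A B → RJ+ Ax A C → RJ+ Ax A (B ∧ C)
  nec    : ∀ {α A B} → RJ+ Ax A B → RJ+ Ax (⟨ α ⟩ A) (⟨ α ⟩ B)
  trans  : ∀ {α A} → RJ+ Ax (⟨ α ⟩ ⟨ α ⟩ A) (⟨ α ⟩ A)
  transˡ : ∀ {α β A} → β ≤ᵐ α → RJ+ Ax (⟨ α ⟩ ⟨ β ⟩ A) (⟨ β ⟩ A)
  transʳ : ∀ {α β A} → β ≤ᵐ α → RJ+ Ax (⟨ β ⟩ ⟨ α ⟩ A) (⟨ β ⟩ A)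
  J      : ∀ {α β A B} → β <ᵐ α → RJ+ Ax (⟨ α ⟩ A ∧ ⟨ β ⟩ B) (⟨ α ⟩ (A ∧ ⟨ β ⟩ B))

data Monotonicity : Rel Formula 0ℓ where
  mono : ∀ {α β A} → β <ᵐ α → Monotonicity (⟨ α ⟩ A) (⟨ β ⟩ A)

infix 4 _⊢RJ_ _⊢RC_

_⊢RJ_ : Rel Formula 0ℓ
_⊢RJ_ = RJ+ Never

_⊢RC_ : Rel Formula 0ℓ
_⊢RC_ = RJ+ Monotonicity

data Symbol : Set where
  var              : ℕ → Symbol
  mod              : Modality → Symbol
  ⊤ lpar ∧ rpar ⊢ : Symbol

-- Formulas as words; conjunctions are written with parentheses: (A∧B).
word : Formula → List Symbol
word (var p)   = [ var p ]
word ⊤         = [ ⊤ ]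
word (A ∧ B)   = lpar ∷ word A ++ ∧ ∷ word B ++ [ rpar ]
word (⟨ α ⟩ A) = mod α ∷ word A

∣_∣ : Formula → ℕ
∣ A ∣ = length (word A)

------------------------------------------------------------------------
-- Unit-cost random access machines over symbols and natural numbers.
--
-- A register or memory cell holds one symbol or one number; memory is
-- addressed by numbers. Symbols are atomic: they can only be copied,
-- tested for equality and for their kind, and modalities can be compared
-- in the order of ordinals. There is no multiplication of numbers.

data Value : Set where
  num : ℕ → Value
  sym : Symbol → Value

-- Arithmetic and addressing treat a symbol as 0.
toNum : Value → ℕ
toNum (num k) = k
toNum (sym _) = 0

_==ˢ_ : Symbol → Symbol → Bool
var p ==ˢ var q = p ≡ᵇ q
mod α ==ˢ mod β = does (α ≟ᵐ β)
⊤     ==ˢ ⊤     = true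
lpar  ==ˢ lpar  = true
∧     ==ˢ ∧     = true
rpar  ==ˢ rpar  = true
⊢     ==ˢ ⊢     = true
_     ==ˢ _     = false

_==_ : Value → Value → Bool
num k == num l = k ≡ᵇ l
sym a == sym b = a ==ˢ b
_     == _     = false

_<<_ : Value → Value → Bool
num k       << num l       = k <ᵇ l
sym (mod α) << sym (mod β) = does (α <ᵐ? β)
_           << _           = false

isVar : Value → Bool
isVar (sym (var _)) = true
isVar _             = false

isMod : Value → Bool
isMod (sym (mod _)) = true
isMod _             = false

Register Label : Set
Register = ℕ
Label    = ℕ

data Test : Set where
  eq lt   : Register → Register → Test
  var mod : Register → Test

data Instruction : Set where
  const   : Register → Value → Instruction               -- r ≔ v
  move    : Register → Register → Instruction            -- r ≔ s
  add sub : Register → Register → Register → Instruction -- r ≔ s + t, r ≔ s ∸ t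
  load    : Register → Register → Instruction            -- r ≔ memory[s]
  store   : Register → Register → Instruction            -- memory[r] ≔ s
  jump    : Label → Instruction
  branch  : Test → Label → Instruction
  halt    : Bool → Instruction

Program : Set
Program = List Instruction

record Config : Set where
  constructor ⟪_,_,_⟫
  field
    pc     : Label
    regs   : Register → Value
    memory : ℕ → Value

_[_≔_] : (ℕ → Value) → ℕ → Value → (ℕ → Value)
(f [ i ≔ v ]) j = if i ≡ᵇ j then v else f j

holds : Test → (Register → Value) → Bool
holds (eq r s) R = R r == R s
holds (lt r s) R = R r << R s
holds (var r)  R = isVar (R r)
holds (mod r)  R = isMod (R r)

-- Executing one instruction yields the next configuration or, for halt, the output.
exec : Instruction → Config → Config ⊎ Bool
exec (const r v)  ⟪ l , R , M ⟫ = inj₁ ⟪ suc l , R [ r ≔ v ] , M ⟫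
exec (move r s)   ⟪ l , R , M ⟫ = inj₁ ⟪ suc l , R [ r ≔ R s ] , M ⟫
exec (add r s t)  ⟪ l , R , M ⟫ = inj₁ ⟪ suc l , R [ r ≔ num (toNum (R s) + toNum (R t)) ] , M ⟫
exec (sub r s t)  ⟪ l , R , M ⟫ = inj₁ ⟪ suc l , R [ r ≔ num (toNum (R s) ∸ toNum (R t)) ] , M ⟫
exec (load r s)   ⟪ l , R , M ⟫ = inj₁ ⟪ suc l , R [ r ≔ M (toNum (R s)) ] , M ⟫
exec (store r s)  ⟪ l , R , M ⟫ = inj₁ ⟪ suc l , R , M [ toNum (R r) ≔ R s ] ⟫
exec (jump k)     ⟪ l , R , M ⟫ = inj₁ ⟪ k , R , M ⟫
exec (branch c k) ⟪ l , R , M ⟫ = inj₁ ⟪ (if holds c R then k else suc l) , R , M ⟫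
exec (halt b)     _             = inj₂ b

fetch : Program → Label → Maybe Instruction
fetch P l = head (drop l P)

-- P ▹ c ⇓ b [ t ]: started in c, the program P halts with output b after
-- executing exactly t instructions. Leaving the program is not halting.
data _▹_⇓_[_] (P : Program) (c : Config) (b : Bool) : ℕ → Set where
  done : ∀ {i} → fetch P (Config.pc c) ≡ just i → exec i c ≡ inj₂ b →
         P ▹ c ⇓ b [ 1 ]
  next : ∀ {i c′ t} → fetch P (Config.pc c) ≡ just i → exec i c ≡ inj₁ c′ →
         P ▹ c′ ⇓ b [ t ] → P ▹ c ⇓ b [ suc t ]

-- The input word A ⊢ B occupies the memory from address 0 on; all other
-- cells and all registers contain the number 0.
initial : Formula → Formula → Config
initial A B = ⟪ 0 , (λ _ → num 0) , (λ i → maybe′ sym (num 0) (head (drop i input))) ⟫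
  where input = word A ++ ⊢ ∷ word B

-- One program decides R, in O(f) steps.
DecidableInTimeO : (Formula → Formula → ℕ) → Rel Formula 0ℓ → Set
DecidableInTimeO f R =
  ∃[ P ] ∃[ C ] ∀ A B → ∃[ b ] ∃[ t ]
    P ▹ initial A B ⇓ b [ t ] × t ≤ C * f A B × Reflects (R A B) b

-- |ℓ({A,B})|, read as 1 when no modality occurs: otherwise a bound with
-- this factor would allow 0 steps for modality-free sequents.
n[_,_] : Formula → Formula → ℕ
n[ A , B ] = length (ℓ (A ∷ B ∷ [])) ⊔ 1

{-# OPTIONS --safe #-}
module Submission where

-- Over a tree whose edges carry modalities (the tree of subformulas of A that
-- begin with a modality, with A itself at the root), let x R_β y hold if some z
-- above or equal to x is connected to x by edges labelled > β and to y by edges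
-- labelled ≥ β, one of which is a "hit": labelled exactly β for RJ, and
-- arbitrary for RC. These relations satisfy the frame conditions of the logic,
-- and conversely everything forced at the root is derivable from A, because J
-- carries ⟨β⟩-formulas down edges labelled > β; hence A ⊢ B iff B is forced at
-- the root. As every node precedes its descendants in the word A, the
-- truth values of ⟨β⟩C at all nodes are obtained from those of C by one sweep
-- over A from right to left (which nodes reach C, with or without a hit) and
-- one from left to right (inheritance along edges > β). A stack machine reading B
-- backwards therefore decides A ⊢ B in O(|A|·|B|) steps, which is within all
-- four bounds.

open import Defs renaming (∧ to ∧ˢ)
open import Data.Bool.Base using (Bool; true; false; if_then_else_; T)
open import Data.Empty using (⊥; ⊥-elim)
open import Data.List.Base using (List; []; _∷_; _++_; length; map; drop; head)
open import Data.List.Properties using (++-assoc; ++-identityʳ; length-++; length-map; map-++)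
open import Data.List.Relation.Unary.All using (All; []; _∷_)
open import Data.List.Relation.Unary.All.Properties using (++⁺)
open import Data.Maybe.Base using (Maybe; just; nothing; maybe′)
open import Data.Maybe.Properties using (just-injective)
open import Data.Nat.Base using (ℕ; zero; suc; _+_; _*_; _∸_; _^_; _⊔_; _≤_; _<_; z≤n; s≤s; _≡ᵇ_)
import Data.Nat.Properties as ℕ
open import Data.Nat.Solver using (module +-*-Solver)
open import Data.Product.Base using (∃-syntax; _×_; _,_; proj₁; proj₂)
open import Data.Sum.Base using (_⊎_; inj₁; inj₂)
open import Data.Unit.Base using (tt) renaming (⊤ to 𝟙)
open import Level using (0ℓ)
import Relation.Binary.Construct.Add.Supremum.NonStrict _≤_ as NonStrict
import Relation.Binary.Construct.Add.Supremum.Strict _<_ as Strict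
open import Relation.Binary.Construct.Never using (Never)
open import Relation.Binary.Core using (Rel)
open import Relation.Binary.PropositionalEquality as ≡ using (_≡_; _≢_; refl; cong; subst; module ≡-Reasoning)
open import Relation.Nullary.Construct.Add.Supremum using ([_]; ⊤⁺)
open import Relation.Nullary.Decidable.Core using (proof; yes; no)
open import Relation.Nullary.Negation.Core using (¬_)
open import Relation.Nullary.Reflects using (Reflects; ofʸ; ofⁿ)

open +-*-Solver using (solve; con; _:+_; _:*_; _:=_)
open NonStrict using ([_]; _≤⊤⁺)
open Strict using ([_]; [_]<⊤⁺)

-- With the common ancestor `z` quantified just once, every frame condition reduces to comparing two
-- ancestors of one world. In a tree one of them lies above the other, so the paths can be spliced
-- and no transitive closure is taken. The hit reflects the lack of monotonicity in RJ. A path whose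
-- labels all exceed β yields no ⟨β⟩-formula there, but once a single edge is labelled β the two
-- transitivity axioms absorb every other label ≥ β, above and below it. In RC each label ≥ β can be
-- lowered to β. The relation `Hit` is therefore the only difference between the two semantics, and
-- in the program it affects only the mark passed along an edge > β. For completeness a world cannot
-- be described by its own subformula alone, since J adds to it formulas that come from its
-- ancestors. Derivability at a world is therefore defined relative to a finite conjunction of such
-- formulas, and it is turned back into derivability from A by moving that conjunction under the
-- modality of the edge.

private variable
  α β γ δ : Modality
  A B C D : Formula

-- Modalities

<ᵐ⇒≤ᵐ : α <ᵐ β → α ≤ᵐ β
<ᵐ⇒≤ᵐ [ p ]     = [ ℕ.<⇒≤ p ]
<ᵐ⇒≤ᵐ [ k ]<⊤⁺ = _ ≤⊤⁺

≤ᵐ-refl : α ≤ᵐ α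
≤ᵐ-refl = NonStrict.≤⁺-reflexive-≡ ℕ.≤-reflexive refl

≤ᵐ-trans : α ≤ᵐ β → β ≤ᵐ γ → α ≤ᵐ γ
≤ᵐ-trans = NonStrict.≤⁺-trans ℕ.≤-trans

≤ᵐ-<ᵐ-trans : α ≤ᵐ β → β <ᵐ γ → α <ᵐ γ
≤ᵐ-<ᵐ-trans = Strict.<⁺-transʳ ℕ.≤-<-trans

<ᵐ-≤ᵐ-trans : α <ᵐ β → β ≤ᵐ γ → α <ᵐ γ
<ᵐ-≤ᵐ-trans = Strict.<⁺-transˡ ℕ.<-≤-trans

<ᵐ-irrefl : ¬ (α <ᵐ α)
<ᵐ-irrefl = Strict.<⁺-irrefl-≡ ℕ.<-irrefl refl

≤ᵐ⇒<ᵐ⊎≡ : α ≤ᵐ β → α <ᵐ β ⊎ α ≡ β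
≤ᵐ⇒<ᵐ⊎≡ [ p ] with ℕ.m≤n⇒m<n∨m≡n p
... | inj₁ q    = inj₁ [ q ]
... | inj₂ refl = inj₂ refl
≤ᵐ⇒<ᵐ⊎≡ ([ k ] ≤⊤⁺) = inj₁ [ k ]<⊤⁺
≤ᵐ⇒<ᵐ⊎≡ (⊤⁺ ≤⊤⁺)    = inj₂ refl

-- Trees of worlds

-- The occurrence of a subformula at a position of the word A₀, together
-- with its world: 0 for the root, suc k for the modality at position k.
data Occ (A₀ : Formula) : Formula → ℕ → ℕ → Set where
  here  : Occ A₀ A₀ 0 0
  left  : ∀ {A B w i} → Occ A₀ (A ∧ B) w i → Occ A₀ A w (suc i)
  right : ∀ {A B w i} → Occ A₀ (A ∧ B) w i → Occ A₀ B w (suc (suc i + ∣ A ∣))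
  body  : ∀ {α A w i} → Occ A₀ (⟨ α ⟩ A) w i → Occ A₀ A (suc i) (suc i)

Occ⇒≤ : ∀ {A₀ w i} → Occ A₀ A w i → w ≤ i
Occ⇒≤ here      = z≤n
Occ⇒≤ (left o)  = ℕ.m≤n⇒m≤1+n (Occ⇒≤ o)
Occ⇒≤ (right o) = ℕ.m≤n⇒m≤1+n (ℕ.m≤n⇒m≤1+n (ℕ.m≤n⇒m≤n+o _ (Occ⇒≤ o)))
Occ⇒≤ (body o)  = ℕ.≤-refl

Cell : Set
Cell = Symbol × ℕ × Formula

-- Each symbol comes with its world and the subformula that starts there (⊤ as a placeholder for ∧ and the right parenthesis).
cells : Formula → ℕ → ℕ → List Cell
cells (var p)   w i = ((var p , w , var p) ∷ [])
cells ⊤         w i = ((⊤ , w , ⊤) ∷ [])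
cells (A ∧ B)   w i = (lpar , w , A ∧ B) ∷ cells A w (suc i) ++ (∧ˢ , w , ⊤) ∷
                      cells B w (suc (suc i + ∣ A ∣)) ++ ((rpar , w , ⊤) ∷ [])
cells (⟨ α ⟩ A) w i = (mod α , w , ⟨ α ⟩ A) ∷ cells A (suc i) (suc i)

word-cells : ∀ A w i → map proj₁ (cells A w i) ≡ word A
word-cells (var p)   w i = refl
word-cells ⊤         w i = refl
word-cells (A ∧ B)   w i
  rewrite map-++ proj₁ (cells A w (suc i)) ((∧ˢ , w , ⊤) ∷ cells B w (suc (suc i + ∣ A ∣)) ++ ((rpar , w , ⊤) ∷ []))
        | map-++ proj₁ (cells B w (suc (suc i + ∣ A ∣))) ((rpar , w , ⊤) ∷ [])
        | word-cells A w (suc i) | word-cells B w (suc (suc i + ∣ A ∣)) = refl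
word-cells (⟨ α ⟩ A) w i = cong (_ ∷_) (word-cells A _ _)

length-cells : ∀ A w i → length (cells A w i) ≡ ∣ A ∣
length-cells A w i = ≡.trans (≡.sym (length-map proj₁ (cells A w i))) (cong length (word-cells A w i))

-- Lists by position, and occurrences as positions

nth : ∀ {X : Set} → List X → ℕ → Maybe X
nth xs k = head (drop k xs)

nth-++ : ∀ {X : Set} (xs : List X) {ys k} → nth (xs ++ ys) (length xs + k) ≡ nth ys k
nth-++ []       = refl
nth-++ (x ∷ xs) = nth-++ xs

nth-< : ∀ {X : Set} (xs : List X) {k} → k < length xs → ∃[ x ] nth xs k ≡ just x
nth-< (x ∷ xs) {zero}  _       = x , refl
nth-< (x ∷ xs) {suc k} (s≤s p) = nth-< xs p

nth⇒< : ∀ {X : Set} (xs : List X) {k x} → nth xs k ≡ just x → k < length xs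
nth⇒< []       {zero}  ()
nth⇒< []       {suc k} ()
nth⇒< (x ∷ xs) {zero}  p = s≤s z≤n
nth⇒< (x ∷ xs) {suc k} p = s≤s (nth⇒< xs {k} p)

nth-map : ∀ {X Y : Set} (f : X → Y) (xs : List X) {k x} → nth xs k ≡ just x → nth (map f xs) k ≡ just (f x)
nth-map f (x ∷ xs) {zero}  refl = refl
nth-map f []       {zero}  ()
nth-map f []       {suc k} ()
nth-map f (x ∷ xs) {suc k} p    = nth-map f xs {k} p

nth-++ˡ : ∀ {X : Set} (xs : List X) {ys k x} → nth xs k ≡ just x → nth (xs ++ ys) k ≡ just x
nth-++ˡ (x ∷ xs) {k = zero}  e = e
nth-++ˡ []       {k = zero}  ()
nth-++ˡ []       {k = suc k} ()
nth-++ˡ (x ∷ xs) {k = suc k} e = nth-++ˡ xs {k = k} e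

nth-All : ∀ {X : Set} {P : X → Set} {xs} → All P xs → ∀ k {x} → nth xs k ≡ just x → P x
nth-All (p ∷ ps) zero    refl = p
nth-All (p ∷ ps) (suc k) e    = nth-All ps k e

nth-length : ∀ {X : Set} (xs : List X) → nth xs (length xs) ≡ nothing
nth-length []       = refl
nth-length (x ∷ xs) = nth-length xs

AllAt : ∀ {X : Set} → (ℕ → X → Set) → ℕ → List X → Set
AllAt P i []       = 𝟙
AllAt P i (x ∷ xs) = P i x × AllAt P (suc i) xs

AllAt-++ : ∀ {X : Set} {P : ℕ → X → Set} {i} (xs : List X) {ys n} → length xs ≡ n →
           AllAt P i xs → AllAt P (i + n) ys → AllAt P i (xs ++ ys)
AllAt-++ {i = i} [] refl p q rewrite ℕ.+-identityʳ i = q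
AllAt-++ {P = P} {i} (x ∷ xs) {ys} refl (p , ps) q =
  p , AllAt-++ xs refl ps (subst (λ n → AllAt P n ys) (ℕ.+-suc i (length xs)) q)

AllAt-nth : ∀ {X : Set} {P : ℕ → X → Set} {i} (xs : List X) → AllAt P i xs →
            ∀ k {x} → nth xs k ≡ just x → P (i + k) x
AllAt-nth {P = P} {i} (x ∷ xs) (p , ps) zero    refl = subst (λ n → P n x) (≡.sym (ℕ.+-identityʳ i)) p
AllAt-nth {P = P} {i} (x ∷ xs) (p , ps) (suc k) {y} e =
  subst (λ n → P n y) (≡.sym (ℕ.+-suc i k)) (AllAt-nth xs ps k e)

AllAt-++⁻ : ∀ {X : Set} {P : ℕ → X → Set} {i} (xs : List X) {ys n} → length xs ≡ n →
            AllAt P i (xs ++ ys) → AllAt P i xs × AllAt P (i + n) ys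
AllAt-++⁻ {i = i} [] refl p rewrite ℕ.+-identityʳ i = tt , p
AllAt-++⁻ {P = P} {i} (x ∷ xs) {ys} refl (p , ps) with AllAt-++⁻ xs refl ps
... | q , r = (p , q) , subst (λ n → AllAt P n ys) (≡.sym (ℕ.+-suc i (length xs))) r

Occ⇒cells : ∀ {A₀ w i} → Occ A₀ A w i →
            ∃[ pre ] ∃[ post ] cells A₀ 0 0 ≡ pre ++ cells A w i ++ post × length pre ≡ i
Occ⇒cells here = [] , [] , ≡.sym (++-identityʳ _) , refl
Occ⇒cells (left {A} {B} {w} {i} o) with Occ⇒cells o
... | pre , post , e , len = pre ++ ((lpar , w , A ∧ B) ∷ []) , _ , ≡.trans e
        (≡.trans (cong (λ u → pre ++ (lpar , w , A ∧ B) ∷ u) (++-assoc (cells A w (suc i)) _ post))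
                 (≡.sym (++-assoc pre _ _))) ,
      (≡.trans (length-++ pre) (≡.trans (ℕ.+-comm _ 1) (cong suc len)))
Occ⇒cells (right {A} {B} {w} {i} o) with Occ⇒cells o
... | pre , post , e , len = pre ++ (lpar , w , A ∧ B) ∷ cells A w (suc i) ++ ((∧ˢ , w , ⊤) ∷ []) , _ , ≡.trans e
        (≡.trans (cong (λ u → pre ++ (lpar , w , A ∧ B) ∷ u)
                    (≡.trans (++-assoc (cells A w (suc i)) _ post)
                      (≡.trans (cong (λ u → cells A w (suc i) ++ (∧ˢ , w , ⊤) ∷ u) (++-assoc (cells B w _) _ post))
                               (≡.sym (++-assoc (cells A w (suc i)) _ _)))))
                 (≡.sym (++-assoc pre _ _))) ,
      (begin
        length (pre ++ _ ∷ cells A w (suc i) ++ _ ∷ [])    ≡⟨ length-++ pre ⟩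
        length pre + suc (length (cells A w (suc i) ++ _ ∷ []))
          ≡⟨ ≡.cong₂ (λ m n → m + suc n) len (≡.trans (length-++ (cells A w (suc i))) (≡.cong (_+ 1) (length-cells A w (suc i)))) ⟩
        i + suc (∣ A ∣ + 1)                                ≡⟨ ℕ.+-suc i _ ⟩
        suc (i + (∣ A ∣ + 1))                              ≡⟨ cong (λ m → suc (i + m)) (ℕ.+-comm ∣ A ∣ 1) ⟩
        suc (i + suc ∣ A ∣)                                ≡⟨ cong suc (ℕ.+-suc i _) ⟩
        suc (suc i + ∣ A ∣)                                ∎)
  where open ≡-Reasoning
Occ⇒cells (body {α} {A} {w} {i} o) with Occ⇒cells o
... | pre , post , e , len = pre ++ ((mod α , w , ⟨ α ⟩ A) ∷ []) , post , ≡.trans e (≡.sym (++-assoc pre _ _)) ,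
      (≡.trans (length-++ pre) (≡.trans (ℕ.+-comm _ 1) (cong suc len)))

firstSymbol : Formula → Symbol
firstSymbol (var p)   = var p
firstSymbol ⊤         = ⊤
firstSymbol (A ∧ B)   = lpar
firstSymbol (⟨ α ⟩ A) = mod α

Occ⇒nth : ∀ {A₀ w i} → Occ A₀ A w i → nth (cells A₀ 0 0) i ≡ just (firstSymbol A , w , A)
Occ⇒nth {A} {A₀} {w} {i} o with Occ⇒cells o
... | pre , post , e , refl rewrite e | ≡.sym (ℕ.+-identityʳ (length pre)) | nth-++ pre {cells A w (length pre + 0) ++ post} {0} = first A
  where
  first : ∀ A {w i post} → nth (cells A w i ++ post) 0 ≡ just (firstSymbol A , w , A)
  first (var p)   = refl
  first ⊤         = refl
  first (A ∧ B)   = refl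
  first (⟨ α ⟩ A) = refl

-- Both occurrences describe the same entry of `cells A₀ 0 0`, and that entry records world and
-- formula. This is what makes the worlds a tree: a world determines its incoming edge.
Occ-unique : ∀ {A₀ w v i} → Occ A₀ A w i → Occ A₀ B v i → A ≡ B × w ≡ v
Occ-unique o o′ with just-injective (≡.trans (≡.sym (Occ⇒nth o)) (Occ⇒nth o′))
... | refl = refl , refl

Described : Formula → ℕ → Cell → Set
Described A₀ i (var p , w , _) = w ≤ i × Occ A₀ (var p) w i
Described A₀ i (mod α , w , _) = w ≤ i × ∃[ B ] Occ A₀ (⟨ α ⟩ B) w i
Described A₀ i (_     , w , _) = w ≤ i

described : ∀ {A₀} A {w i} → Occ A₀ A w i → AllAt (Described A₀) i (cells A w i)
described (var p)   o = (Occ⇒≤ o , o) , tt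
described ⊤         o = Occ⇒≤ o , tt
described {A₀} (A ∧ B) {w} {i} o =
  Occ⇒≤ o ,
  AllAt-++ (cells A w (suc i)) (length-cells A w (suc i)) (described A (left o))
    (ℕ.m≤n⇒m≤1+n (ℕ.m≤n⇒m≤n+o ∣ A ∣ (Occ⇒≤ o)) ,
     AllAt-++ (cells B w _) refl (described B (right o))
       (ℕ.m≤n⇒m≤n+o _ (Occ⇒≤ (right o)) , tt))
described (⟨ α ⟩ A) o = (Occ⇒≤ o , A , o) , described A (body o)

-- Kripke semantics on the tree of A₀

module Semantics (Hit : Rel Modality 0ℓ) (Hit⇒≤ : ∀ {β δ} → Hit β δ → β ≤ᵐ δ) (A₀ : Formula) where

  Edge : ℕ → Modality → ℕ → Set
  Edge z δ c = ∃[ k ] ∃[ B ] c ≡ suc k × Occ A₀ (⟨ δ ⟩ B) z k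

  Edge-unique : ∀ {z z′ δ δ′ c} → Edge z δ c → Edge z′ δ′ c → z ≡ z′ × δ ≡ δ′
  Edge-unique (k , _ , refl , o) (_ , _ , refl , o′) with Occ-unique o o′
  ... | refl , refl = refl , refl

  data Path (P : Modality → Set) (z : ℕ) : ℕ → Set where
    []  : Path P z z
    _▷_ : ∀ {x δ y} → Path P z x → P δ × Edge x δ y → Path P z y

  private variable
    P Q : Modality → Set
    u v w x y z : ℕ

  _⋈_ : Path P x y → Path P y z → Path P x z
  p ⋈ []      = p
  p ⋈ (q ▷ e) = (p ⋈ q) ▷ e

  weaken : (∀ {δ} → P δ → Q δ) → Path P x y → Path Q x y
  weaken f []            = []
  weaken f (p ▷ (h , e)) = weaken f p ▷ (f h , e)

  -- The paths are stripped at their common lower end, where the last edges coincide. The one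
  -- exhausted first starts on the other, and the rest of the other connects the two starting
  -- points.
  compare : Path P u y → Path Q v y → Path Q v u ⊎ Path P u v
  compare p             []              = inj₂ p
  compare []            q               = inj₁ q
  compare (p ▷ (_ , e)) (q ▷ (_ , e′)) with Edge-unique e e′
  ... | refl , refl = compare p q

  HitPath : Modality → ℕ → ℕ → Set
  HitPath β z y = ∃[ u ] ∃[ δ ] ∃[ v ] Path (β ≤ᵐ_) z u × Hit β δ × Edge u δ v × Path (β ≤ᵐ_) v y

  forget : HitPath β x y → Path (β ≤ᵐ_) x y
  forget (_ , _ , _ , p , h , e , q) = (p ▷ (Hit⇒≤ h , e)) ⋈ q

  _⋈ʰ_ : Path (β ≤ᵐ_) x y → HitPath β y z → HitPath β x z
  p ⋈ʰ (_ , _ , _ , q , r) = _ , _ , _ , p ⋈ q , r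

  Acc : Modality → ℕ → ℕ → Set
  Acc β x y = ∃[ z ] Path (β <ᵐ_) z x × HitPath β z y

  Force : ℕ → Formula → Set
  Force x (var p)   = ∃[ k ] Occ A₀ (var p) x k
  Force x ⊤         = 𝟙
  Force x (A ∧ B)   = Force x A × Force x B
  Force x (⟨ β ⟩ A) = ∃[ y ] Acc β x y × Force y A

  -- `u` and `v` are both ancestors of `y`; the higher one serves as the common ancestor of `x` and
  -- `z`. The hit is always that of the second access.
  Acc-transˡ : β ≤ᵐ α → Acc α x y → Acc β y z → Acc β x z
  Acc-transˡ β≤α (u , p , h) (v , q , g) with compare (forget h) q
  ... | inj₁ r = v , r ⋈ weaken (≤ᵐ-<ᵐ-trans β≤α) p , g
  ... | inj₂ r = u , weaken (≤ᵐ-<ᵐ-trans β≤α) p , weaken (≤ᵐ-trans β≤α) r ⋈ʰ g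

  -- The labels on the hit path of the first access are ≥ α > β, so it may be appended to the path
  -- by which `y` hangs below the common ancestor.
  Acc-J : β <ᵐ α → Acc α x y → Acc β x z → Acc β y z
  Acc-J β<α (u , p , h) (v , q , g) with compare p q
  ... | inj₁ r = v , r ⋈ weaken (<ᵐ-≤ᵐ-trans β<α) (forget h) , g
  ... | inj₂ r = u , weaken (<ᵐ-≤ᵐ-trans β<α) (forget h) , weaken (λ l → <ᵐ⇒≤ᵐ (<ᵐ-≤ᵐ-trans β<α (<ᵐ⇒≤ᵐ l))) r ⋈ʰ g

  -- By antitonicity the hit of the second access is also a hit for β, so the first access has to
  -- contribute nothing but its path.
  Acc-transʳ-mono : (∀ {α β δ} → β ≤ᵐ α → Hit α δ → Hit β δ) →
                    β ≤ᵐ α → Acc β x y → Acc α y z → Acc β x z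
  Acc-transʳ-mono anti β≤α (u , p , h) (v , q , (_ , _ , _ , g₁ , k , e , g₂))
    with compare (forget h) q
       | (_ , _ , _ , weaken (≤ᵐ-trans β≤α) g₁ , anti β≤α k , e , weaken (≤ᵐ-trans β≤α) g₂)
  ... | inj₁ r | g = v , weaken (≤ᵐ-<ᵐ-trans β≤α) r ⋈ p , g
  ... | inj₂ r | g = u , p , r ⋈ʰ g

  -- Here an α-hit need not be a β-hit, so the hit of the first access has to survive; the
  -- comparison is therefore made with the part `h₂` below that hit.
  Acc-transʳ-exact : (∀ {β δ} → Hit β δ → ¬ (β <ᵐ δ)) →
                     β ≤ᵐ α → Acc β x y → Acc α y z → Acc β x z
  Acc-transʳ-exact {β} {α} {z = z} exact β≤α (u , p , (_ , _ , _ , h₁ , k , e , h₂)) (v , q , g)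
    with compare h₂ q
  ... | inj₂ r = u , p , _ , _ , _ , h₁ , k , e , r ⋈ weaken (≤ᵐ-trans β≤α) (forget g)
  ... | inj₁ [] = u , p , _ , _ , _ , h₁ , k , e , weaken (≤ᵐ-trans β≤α) (forget g)
  -- If `v` is strictly above the lower end of the hit, the hit edge lies on the path with labels >
  -- α ≥ β, which contradicts exactness.
  ... | inj₁ (r ▷ (α<δ , e′)) with Edge-unique e e′
  ...   | refl , refl = ⊥-elim (exact k (≤ᵐ-<ᵐ-trans β≤α α<δ))

  -- Soundness and completeness for the tree of `A₀`

  module Soundness (Ax : Rel Formula 0ℓ) (Ax-sound : ∀ {A B x} → Ax A B → Force x A → Force x B)
    (Acc-transʳ : ∀ {α β x y z} → β ≤ᵐ α → Acc β x y → Acc α y z → Acc β x z) where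

    sound : RJ+ Ax A B → Force x A → Force x B
    sound (axiom a)   f = Ax-sound a f
    sound id          f = f
    sound top         f = tt
    sound (cut d d′)  f = sound d′ (sound d f)
    sound ∧-l         f = proj₁ f
    sound ∧-r         f = proj₂ f
    sound (∧-i d d′)  f = sound d f , sound d′ f
    sound (nec d)     (y , r , f) = y , r , sound d f
    sound trans       (y , r , z , r′ , f) = z , Acc-transˡ ≤ᵐ-refl r r′ , f
    sound (transˡ le) (y , r , z , r′ , f) = z , Acc-transˡ le r r′ , f
    sound (transʳ le) (y , r , z , r′ , f) = z , Acc-transʳ le r r′ , f
    sound (J l)       ((y , r , f) , (z , r′ , g)) = y , r , f , z , Acc-J l r r′ , g

  module Completeness (Ax : Rel Formula 0ℓ)
    (Hit-sound : ∀ {β δ C} → Hit β δ → RJ+ Ax (⟨ δ ⟩ C) (⟨ β ⟩ C)) where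

    infix 4 _⊩_
    _⊩_ : Rel Formula 0ℓ
    _⊩_ = RJ+ Ax

    -- The formulas that J can move under ⟨δ⟩. Conjunctions are included because two consequences of
    -- a world may rest on different exports, which `Theory-∧` has to merge.
    data Boxed (δ : Modality) : Formula → Set where
      top : Boxed δ ⊤
      box : ∀ {β D} → β <ᵐ δ → Boxed δ (⟨ β ⟩ D)
      and : ∀ {S S′} → Boxed δ S → Boxed δ S′ → Boxed δ (S ∧ S′)

    J* : ∀ {S} → Boxed δ S → ⟨ δ ⟩ B ∧ S ⊩ ⟨ δ ⟩ (B ∧ S)
    J* top       = cut ∧-l (nec (∧-i id top))
    J* (box l)   = J l
    J* (and s s′) = cut (∧-i (cut (∧-i ∧-l (cut ∧-r ∧-l)) (J* s)) (cut ∧-r ∧-r))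
                   (cut (J* s′) (nec (∧-i (cut ∧-l ∧-l) (∧-i (cut ∧-l ∧-r) ∧-r))))

    -- The theory of a world: that of its formula together with what J exports to it from its parent.
    data Theory : ℕ → Formula → Set where
      root  : A₀ ⊩ C → Theory 0 C
      child : ∀ {z k S} → Occ A₀ (⟨ δ ⟩ B) z k → Boxed δ S → Theory z S → B ∧ S ⊩ C → Theory (suc k) C

    Theory-⊩ : Theory x C → C ⊩ D → Theory x D
    Theory-⊩ (root d)         d′ = root (cut d d′)
    Theory-⊩ (child o s t d) d′ = child o s t (cut d d′)

    -- The occurrence certifies that `x` is a world; other numbers have an empty theory, without
    -- even `⊤`.
    Theory-⊤ : Occ A₀ A x u → Theory x ⊤
    Theory-⊤ here      = root top
    Theory-⊤ (left o)  = Theory-⊤ o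
    Theory-⊤ (right o) = Theory-⊤ o
    Theory-⊤ (body o)  = child o top (Theory-⊤ o) top

    Theory-∧ : Theory x C → Theory x D → Theory x (C ∧ D)
    Theory-∧ (root d)        (root d′) = root (∧-i d d′)
    Theory-∧ (child o s t d) (child o′ s′ t′ d′) with Occ-unique o o′
    ... | refl , refl = child o (and s s′) (Theory-∧ t t′)
                          (∧-i (cut (∧-i ∧-l (cut ∧-r ∧-l)) d) (cut (∧-i ∧-l (cut ∧-r ∧-r)) d′))

    Theory-Occ : Occ A₀ A x u → Theory x A
    Theory-Occ here      = root id
    Theory-Occ (left o)  = Theory-⊩ (Theory-Occ o) ∧-l
    Theory-Occ (right o) = Theory-⊩ (Theory-Occ o) ∧-r
    Theory-Occ (body o)  = child o top (Theory-⊤ o) ∧-l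

    -- The parent proves ⟨δ⟩B and the exported conjunction; `J*` moves the latter under ⟨δ⟩, where
    -- the derivation belonging to the child can be applied.
    Theory-up : Edge x δ y → Theory y C → Theory x (⟨ δ ⟩ C)
    Theory-up (_ , _ , refl , o) (child o′ s t d) with Occ-unique o o′
    ... | refl , refl = Theory-⊩ (Theory-∧ (Theory-Occ o) t) (cut (J* s) (nec d))

    Theory-down : Path (β <ᵐ_) x y → Theory x (⟨ β ⟩ C) → Theory y (⟨ β ⟩ C)
    Theory-down []                              t = t
    Theory-down (p ▷ (l , _ , _ , refl , o)) t = child o (box l) (Theory-down p t) ∧-r

    -- Either transitivity axiom keeps the smaller label, which is still ≥ β.
    ⟨⟩-trans : β ≤ᵐ γ → β ≤ᵐ δ → ∃[ ε ] β ≤ᵐ ε × (∀ {C} → ⟨ γ ⟩ ⟨ δ ⟩ C ⊩ ⟨ ε ⟩ C)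
    ⟨⟩-trans {γ = γ} {δ} β≤γ β≤δ with NonStrict.≤⁺-total ℕ.≤-total γ δ
    ... | inj₁ γ≤δ = γ , β≤γ , transʳ γ≤δ
    ... | inj₂ δ≤γ = δ , β≤δ , transˡ δ≤γ

    Theory-≥ : Path (β ≤ᵐ_) x y → ∃[ γ ] β ≤ᵐ γ × Theory y (⟨ γ ⟩ C) → ∃[ γ ] β ≤ᵐ γ × Theory x (⟨ γ ⟩ C)
    Theory-≥ []            t = t
    Theory-≥ (p ▷ (l , e)) (γ , l′ , t) with ⟨⟩-trans l l′
    ... | ε , l″ , d = Theory-≥ p (ε , l″ , Theory-⊩ (Theory-up e t) d)

    Theory-≥-exact : Path (β ≤ᵐ_) x y → Theory y (⟨ β ⟩ C) → Theory x (⟨ β ⟩ C)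
    Theory-≥-exact []            t = t
    Theory-≥-exact (p ▷ (l , e)) t = Theory-≥-exact p (Theory-⊩ (Theory-up e t) (transˡ l))

    -- Below the hit all labels collapse into one γ ≥ β, which `transʳ` absorbs into the ⟨β⟩ of the
    -- hit; above it `transˡ` absorbs each label. With nothing below the hit there is no γ, hence
    -- the separate case.
    Theory-Hit : HitPath β x y → Theory y C → Theory x (⟨ β ⟩ C)
    Theory-Hit (_ , _ , _ , p , h , e , [])           t = Theory-≥-exact p (Theory-⊩ (Theory-up e t) (Hit-sound h))
    Theory-Hit (_ , _ , _ , p , h , e , (q ▷ (l , f))) t with Theory-≥ q (_ , l , Theory-up f t)
    ... | γ , l′ , t′ = Theory-≥-exact p (Theory-⊩ (Theory-up e t′) (cut (Hit-sound h) (transʳ l′)))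

    Force⇒Theory : ∀ C → Occ A₀ A x u → Force x C → Theory x C
    Force⇒Theory (var p)   o (_ , o′)  = Theory-Occ o′
    Force⇒Theory ⊤         o f         = Theory-⊤ o
    Force⇒Theory (C ∧ D)   o (f , g)   = Theory-∧ (Force⇒Theory C o f) (Force⇒Theory D o g)
    -- A hit path has at least one edge, so its end `y` is the target of an edge and thus a world,
    -- as the induction requires.
    Force⇒Theory (⟨ β ⟩ C) o (y , (z , p , h) , f) =
      Theory-down p (Theory-Hit h (Force⇒Theory C (proj₂ (occupied h)) f))
      where
      last : Path Q u v → Edge w δ u → ∃[ B ] Occ A₀ B v v
      last []                          (_ , _ , refl , o) = _ , body o
      last (p ▷ (_ , _ , _ , refl , o)) _                 = _ , body o
      occupied : HitPath β u v → ∃[ B ] Occ A₀ B v v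
      occupied (_ , _ , _ , _ , _ , e , q) = last q e

    complete : Force 0 B → A₀ ⊩ B
    complete {B} f with Force⇒Theory B here f
    ... | root d = d

  -- The edge opened by a modality is a hit for its own label, so the world of the body is a
  -- witness.
  Force-Occ : ∀ A → (∀ {β} → Hit β β) → Occ A₀ A x u → Force x A
  Force-Occ (var p)   h o = _ , o
  Force-Occ ⊤         h o = tt
  Force-Occ (A ∧ B)   h o = Force-Occ A h (left o) , Force-Occ B h (right o)
  Force-Occ (⟨ α ⟩ A) h o = _ , (_ , [] , _ , _ , _ , [] , h , (_ , _ , refl , o) , []) , Force-Occ A h (body o)

-- Structured programs

≡ᵇ-refl : ∀ n → (n ≡ᵇ n) ≡ true
≡ᵇ-refl zero    = refl
≡ᵇ-refl (suc n) = ≡ᵇ-refl n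

≢⇒≡ᵇ : ∀ {m n} → m ≢ n → (m ≡ᵇ n) ≡ false
≢⇒≡ᵇ {m} {n} m≢n with m ≡ᵇ n in e
... | false = refl
... | true  = ⊥-elim (m≢n (ℕ.≡ᵇ⇒≡ m n (subst T (≡.sym e) tt)))

≔-same : ∀ (M : ℕ → Value) a {v} → (M [ a ≔ v ]) a ≡ v
≔-same M a rewrite ≡ᵇ-refl a = refl

≔-other : ∀ (M : ℕ → Value) {a b v} → a ≢ b → (M [ a ≔ v ]) b ≡ M b
≔-other M a≢b rewrite ≢⇒≡ᵇ a≢b = refl

-- Registers as a list, padded with zeros: unlike for register functions,
-- symbolic execution then yields the final list of values by computation.
Store : Set
Store = List Value × (ℕ → Value)

get : List Value → ℕ → Value
get []       r       = num 0
get (v ∷ vs) zero    = v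
get (v ∷ vs) (suc r) = get vs r

set : List Value → ℕ → Value → List Value
set []       zero    v = v ∷ []
set []       (suc r) v = num 0 ∷ set [] r v
set (_ ∷ vs) zero    v = v ∷ vs
set (u ∷ vs) (suc r) v = u ∷ set vs r v

get-set : ∀ vs r v q → get (set vs r v) q ≡ (get vs [ r ≔ v ]) q
get-set []       zero    v zero    = refl
get-set []       zero    v (suc q) = refl
get-set []       (suc r) v zero    = refl
get-set []       (suc r) v (suc q) = get-set [] r v q
get-set (u ∷ vs) zero    v zero    = refl
get-set (u ∷ vs) zero    v (suc q) = refl
get-set (u ∷ vs) (suc r) v zero    = refl
get-set (u ∷ vs) (suc r) v (suc q) = get-set vs r v q

Straight : Instruction → Set
Straight (jump _)     = ⊥
Straight (branch _ _) = ⊥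
Straight (halt _)     = ⊥
Straight _            = 𝟙

Straights : List Instruction → Set
Straights []       = 𝟙
Straights (i ∷ is) = Straight i × Straights is

act : Instruction → Store → Store
act (const r v) (vs , M) = set vs r v , M
act (move r s)  (vs , M) = set vs r (get vs s) , M
act (add r s t) (vs , M) = set vs r (num (toNum (get vs s) + toNum (get vs t))) , M
act (sub r s t) (vs , M) = set vs r (num (toNum (get vs s) ∸ toNum (get vs t))) , M
act (load r s)  (vs , M) = set vs r (M (toNum (get vs s))) , M
act (store r s) (vs , M) = vs , M [ toNum (get vs r) ≔ get vs s ]
act _           σ        = σ

acts : List Instruction → Store → Store
acts []       σ = σ
acts (i ∷ is) σ = acts is (act i σ)

test : Test → Store → Bool
test t (vs , _) = holds t (get vs)

infixr 5 _⨾_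
data Cmd : Set where
  block : (is : List Instruction) {_ : Straights is} → Cmd
  _⨾_   : Cmd → Cmd → Cmd
  cond  : Test → Cmd → Cmd → Cmd
  until : Test → Cmd → Cmd

pattern skip = block []

data Run : Cmd → Store → Store → ℕ → Set where
  block  : ∀ {is s σ} → Run (block is {s}) σ (acts is σ) (length is)
  _⨾_    : ∀ {c d σ σ′ σ″ m n} → Run c σ σ′ m → Run d σ′ σ″ n → Run (c ⨾ d) σ σ″ (m + n)
  cond-t : ∀ {t c d σ σ′ n} → test t σ ≡ true → Run c σ σ′ n → Run (cond t c d) σ σ′ (suc n)
  cond-f : ∀ {t c d σ σ′ n} → test t σ ≡ false → Run d σ σ′ n → Run (cond t c d) σ σ′ (suc (n + 1))
  exit   : ∀ {t c σ} → test t σ ≡ true → Run (until t c) σ σ 1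
  again  : ∀ {t c σ σ′ σ″ m n} → test t σ ≡ false → Run c σ σ′ m → Run (until t c) σ′ σ″ n →
           Run (until t c) σ σ″ (suc (m + suc n))

size : Cmd → ℕ
size (block is)   = length is
size (c ⨾ d)      = size c + size d
size (cond _ c d) = suc (size d + suc (size c))
size (until _ c)  = suc (size c + 1)

-- The false branch comes directly after the test and ends in a jump over the true one, which is why
-- `cond-f` costs one step more than `cond-t`.
compile : Cmd → Label → Program
compile (block is)   l = is
compile (c ⨾ d)      l = compile c l ++ compile d (l + size c)
compile (cond t c d) l = branch t (suc (suc l + size d)) ∷ compile d (suc l) ++
                         jump (l + size (cond t c d)) ∷ compile c (suc (suc l + size d))
compile (until t c)  l = branch t (l + size (until t c)) ∷ compile c (suc l) ++ jump l ∷ []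

length-compile : ∀ c {l} → length (compile c l) ≡ size c
length-compile (block is)   = refl
length-compile (c ⨾ d) {l}  = ≡.trans (length-++ (compile c l)) (≡.cong₂ _+_ (length-compile c) (length-compile d))
length-compile (cond t c d) {l} = cong suc (≡.trans (length-++ (compile d (suc l)))
  (≡.cong₂ _+_ (length-compile d) (cong suc (length-compile c))))
length-compile (until t c) {l} = cong suc (≡.trans (length-++ (compile c (suc l))) (cong (_+ 1) (length-compile c)))

Code : Program → Label → Program → Set
Code P = AllAt (λ l i → fetch P l ≡ just i)

Code-self : ∀ P → Code P 0 P
Code-self P = go [] P
  where
  go : ∀ pre is → Code (pre ++ is) (length pre) is
  go pre []       = tt
  go pre (i ∷ is) =
    subst (λ n → nth (pre ++ i ∷ is) n ≡ just i) (ℕ.+-identityʳ (length pre)) (nth-++ pre {i ∷ is} {0}) ,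
    ≡.subst₂ (λ Q n → Code Q n is) (++-assoc pre _ is)
      (≡.trans (length-++ pre) (ℕ.+-comm (length pre) 1)) (go (pre ++ i ∷ []) is)

infix 4 _≈_
_≈_ : (Register → Value) → List Value → Set
R ≈ vs = ∀ r → R r ≡ get vs r

≈-set : ∀ {R v} vs r → R ≈ vs → (R [ r ≔ v ]) ≈ set vs r v
≈-set {R} {v} vs r e q = ≡.trans (upd (r ≡ᵇ q)) (≡.sym (get-set vs r v q))
  where
  upd : ∀ b → (if b then v else R q) ≡ (if b then v else get vs q)
  upd true  = refl
  upd false = e q

≈-holds : ∀ {R} vs t → R ≈ vs → holds t R ≡ holds t (get vs)
≈-holds vs (eq r s) e rewrite e r | e s = refl
≈-holds vs (lt r s) e rewrite e r | e s = refl
≈-holds vs (var r)  e rewrite e r = refl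
≈-holds vs (mod r)  e rewrite e r = refl

-- Quantifying over all register functions that agree pointwise with the list avoids any appeal to
-- function extensionality.
Halts : Program → Label → Store → Bool → ℕ → Set
Halts P l (vs , M) b t = ∀ R → R ≈ vs → P ▹ ⟪ l , R , M ⟫ ⇓ b [ t ]

act-halts : ∀ {P l b t} i → Straight i → fetch P l ≡ just i → ∀ σ → Halts P (suc l) (act i σ) b t → Halts P l σ b (suc t)
act-halts (const r v) _ f (vs , M) h R e = next f refl (h _ (≈-set vs r e))
act-halts (move r s)  _ f (vs , M) h R e rewrite ≡.sym (e s) = next f refl (h _ (≈-set vs r e))
act-halts (add r s t) _ f (vs , M) h R e rewrite ≡.sym (e s) | ≡.sym (e t) = next f refl (h _ (≈-set vs r e))
act-halts (sub r s t) _ f (vs , M) h R e rewrite ≡.sym (e s) | ≡.sym (e t) = next f refl (h _ (≈-set vs r e))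
act-halts (load r s)  _ f (vs , M) h R e rewrite ≡.sym (e s) = next f refl (h _ (≈-set vs r e))
act-halts (store r s) _ f (vs , M) h R e rewrite ≡.sym (e r) | ≡.sym (e s) = next f refl (h _ e)

acts-halts : ∀ {P l b t} is → Straights is → Code P l is → ∀ σ → Halts P (l + length is) (acts is σ) b t →
             Halts P l σ b (length is + t)
acts-halts {l = l} []       _        _        σ h rewrite ℕ.+-identityʳ l = h
acts-halts {l = l} (i ∷ is) (s , ss) (c , cs) σ h rewrite ℕ.+-suc l (length is) =
  act-halts i s c σ (acts-halts is ss cs (act i σ) h)

jump-halts : ∀ {P l k b t} → fetch P l ≡ just (jump k) → ∀ σ → Halts P k σ b t → Halts P l σ b (suc t)
jump-halts f (vs , M) h R e = next f refl (h R e)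

branch-halts : ∀ {P l c k b t} → fetch P l ≡ just (branch c k) → ∀ σ {v} → test c σ ≡ v →
               Halts P (if v then k else suc l) σ b t → Halts P l σ b (suc t)
branch-halts {P} {l} {c} {k} {b} {t} f (vs , M) p h R e = next f refl
  (subst (λ v → P ▹ ⟪ (if v then k else suc l) , R , M ⟫ ⇓ b [ t ]) (≡.sym (≡.trans (≈-holds vs c e) p)) (h R e))

-- In continuation form: a halting run from the end of the code is extended backwards through the
-- command, so exact step counts simply add up.
simulate : ∀ {P c l σ σ′ b t n} → Run c σ σ′ n → Code P l (compile c l) →
           Halts P (l + size c) σ′ b t → Halts P l σ b (n + t)
simulate {σ = σ} (block {is} {s}) code h = acts-halts is s code σ h
simulate {P} {l = l} {b = b} {t = u} (_⨾_ {c} {d} {σ} {σ′} {σ″} {m} {n} r r′) code h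
  with AllAt-++⁻ (compile c l) (length-compile c) code
... | code-c , code-d rewrite ℕ.+-assoc m n u = simulate r code-c (simulate r′ code-d
      (subst (λ k → Halts P k σ″ b u) (≡.sym (ℕ.+-assoc l _ _)) h))
simulate {P} {l = l} {b = b} {u} (cond-t {t} {c} {d} {σ} {σ′} {n} p r) (f , code) h
  with AllAt-++⁻ (compile d (suc l)) (length-compile d) code
... | code-d , _ , code-c = branch-halts f σ p (simulate r code-c
      (subst (λ k → Halts P k σ′ b u) lemma h))
  where
  lemma : l + suc (size d + suc (size c)) ≡ suc (suc l + size d) + size c
  lemma = ≡.trans (ℕ.+-suc l _) (cong suc (≡.trans (cong (l +_) (ℕ.+-suc (size d) (size c)))
            (≡.trans (ℕ.+-suc l _) (cong suc (≡.sym (ℕ.+-assoc l _ _))))))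
simulate {P} {l = l} {b = b} {u} (cond-f {t} {c} {d} {σ} {σ′} {n} p r) (f , code) h
  with AllAt-++⁻ (compile d (suc l)) (length-compile d) code
... | code-d , f′ , _ rewrite ℕ.+-assoc n 1 u = branch-halts f σ p (simulate r code-d
      (jump-halts f′ σ′ h))
simulate {c = c} {l = l} {σ = σ} (exit p) (f , code) h = branch-halts f σ p h
simulate {l = l} {t = u} (again {t} {c} {σ} {σ′} {σ″} {m} {n} p r r′) (f , code) h
  with AllAt-++⁻ (compile c (suc l)) (length-compile c) code
... | code-c , f′ , _ rewrite ℕ.+-assoc m (suc n) u = branch-halts f σ p (simulate r code-c
      (jump-halts f′ σ′ (simulate r′ (f , code) h)))

-- Total correctness with step bounds

WP : Cmd → ℕ → (Store → Set) → Store → Set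
WP c n Q σ = ∃[ σ′ ] ∃[ m ] Run c σ σ′ m × m ≤ n × Q σ′

module _ where

  private variable
    c d   : Cmd
    k m n : ℕ
    t     : Test
    Q Q′  : Store → Set
    σ     : Store

  weakenWP : n ≤ m → (∀ {σ} → Q σ → Q′ σ) → WP c n Q σ → WP c m Q′ σ
  weakenWP n≤m f (σ′ , k , r , k≤n , q) = σ′ , k , r , ℕ.≤-trans k≤n n≤m , f q

  wp-block : ∀ {is s} → Q (acts is σ) → WP (block is {s}) (length is) Q σ
  wp-block q = _ , _ , block , ℕ.≤-refl , q

  infixr 5 _then_
  _then_ : WP c m Q σ → (∀ {σ} → Q σ → WP d n Q′ σ) → WP (c ⨾ d) (m + n) Q′ σ
  (_ , _ , r , le , q) then f with f q
  ... | _ , _ , r′ , le′ , q′ = _ , _ , r ⨾ r′ , ℕ.+-mono-≤ le le′ , q′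

  infixr 5 _then≡_
  _then≡_ : ∀ {σ′} → WP c m (_≡ σ′) σ → WP d n Q σ′ → WP (c ⨾ d) (m + n) Q σ
  wp then≡ wp′ = wp then λ { refl → wp′ }

  wp-⨾ : ∀ {is s} → WP d n Q (acts is σ) → WP (block is {s} ⨾ d) (length is + n) Q σ
  wp-⨾ {n = n} {is = is} (_ , _ , r , le , q) = _ , _ , block ⨾ r , ℕ.+-monoʳ-≤ (length is) le , q

  -- A loaded value is an application of the abstract memory and does not compute. Giving such a
  -- load a block of its own lets the known value be substituted before symbolic execution goes on.
  wp-load : ∀ {r s vs M v} → M (toNum (get vs s)) ≡ v → WP d n Q (set vs r v , M) → WP (block (load r s ∷ []) ⨾ d) (suc n) Q (vs , M)
  wp-load refl q = wp-⨾ q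

  wp-cond : ∀ {b} → test t σ ≡ b → (b ≡ true → WP c n Q σ) → (b ≡ false → WP d n Q σ) → WP (cond t c d) (2 + n) Q σ
  wp-cond {b = true}  p f g with f refl
  ... | _ , _ , r , le , q = _ , _ , cond-t p r , s≤s (ℕ.m≤n⇒m≤1+n le) , q
  wp-cond {n = n} {b = false} p f g with g refl
  ... | _ , _ , r , le , q = _ , _ , cond-f p r , s≤s (ℕ.≤-trans (ℕ.+-monoˡ-≤ 1 le) (ℕ.≤-reflexive (ℕ.+-comm n 1))) , q

  wp-true : ∀ {t c d n Q σ} → test t σ ≡ true → WP c n Q σ → WP (cond t c d) (suc n) Q σ
  wp-true p (_ , _ , r , le , q) = _ , _ , cond-t p r , s≤s le , q

  wp-false : ∀ {t c d n Q σ} → test t σ ≡ false → WP d n Q σ → WP (cond t c d) (2 + n) Q σ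
  wp-false {n = n} p (_ , _ , r , le , q) =
    _ , _ , cond-f p r , s≤s (ℕ.≤-trans (ℕ.+-monoˡ-≤ 1 le) (ℕ.≤-reflexive (ℕ.+-comm n 1))) , q

  wp-if : ∀ {P : Set} {t c d m n Q σ} → Reflects P (test t σ) → (P → WP c m Q σ) → (¬ P → WP d n Q σ) →
          WP (cond t c d) (2 + (m ⊔ n)) Q σ
  wp-if {t = t} {m = m} {n} {σ = σ} r f g with test t σ in e | r
  ... | true  | ofʸ p = wp-cond e (λ _ → weakenWP (ℕ.m≤m⊔n m n) (λ q → q) (f p)) (λ ())
  ... | false | ofⁿ p = wp-cond e (λ ()) (λ _ → weakenWP (ℕ.m≤n⊔m m n) (λ q → q) (g p))

  wp-exit : test t σ ≡ true → Q σ → WP (until t c) 1 Q σ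
  wp-exit p q = _ , _ , exit p , ℕ.≤-refl , q

  wp-again : test t σ ≡ false → WP c m (WP (until t c) n Q) σ → WP (until t c) (2 + m + n) Q σ
  wp-again {m = m} {n} p (_ , _ , r , le , _ , _ , r′ , le′ , q) =
    _ , _ , again p r r′ , s≤s (ℕ.≤-trans (ℕ.+-mono-≤ le (s≤s le′)) (ℕ.≤-reflexive (ℕ.+-suc m n))) , q

  -- Each round pays 2 for the failed test and the jump back; the final 1 is the test that leaves
  -- the loop.
  wp-downto : (I : ℕ → Store → Set) → (∀ {σ} → I 0 σ → test t σ ≡ true) →
              (∀ j {σ} → I (suc j) σ → test t σ ≡ false × WP c m (I j) σ) →
              ∀ j → I j σ → WP (until t c) (j * (2 + m) + 1) (I 0) σ
  wp-downto I stop step zero    i = wp-exit (stop i) i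
  wp-downto {m = m} I stop step (suc j) i with step j i
  ... | p , w = weakenWP (ℕ.≤-reflexive (≡.sym (ℕ.+-assoc (2 + m) (j * (2 + m)) 1))) (λ x → x)
                  (wp-again p (weakenWP ℕ.≤-refl (wp-downto I stop step j) w))

  wp-upto : (I : ℕ → Store → Set) → ∀ k → (∀ {σ} → I k σ → test t σ ≡ true) →
            (∀ j {σ} → j < k → I j σ → test t σ ≡ false × WP c m (I (suc j)) σ) →
            I 0 σ → WP (until t c) (k * (2 + m) + 1) (I k) σ
  wp-upto {t} {c} {m} I k stop step i = weakenWP ℕ.≤-refl finish
    (wp-downto (λ j σ → ∃[ l ] j + l ≡ k × I l σ)
       (λ { (l , refl , i) → stop i })
       (λ { j (l , e , i) → let p , w = step l (subst (l <_) e (s≤s (ℕ.m≤n+m l j))) i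
                            in p , weakenWP ℕ.≤-refl (λ i → suc l , ≡.trans (ℕ.+-suc j l) e , i) w })
       k (0 , ℕ.+-identityʳ k , i))
    where
    finish : ∀ {σ} → (∃[ l ] 0 + l ≡ k × I l σ) → I k σ
    finish (_ , refl , i) = i

-- The command is expected to leave the constant 1 in register 1 and the answer bit in register 15.
decider : Cmd → Program
decider c = compile c 0 ++ branch (eq 15 1) (2 + size c) ∷ halt false ∷ halt true ∷ []

Answers : Set → Store → Set
Answers X σ = ∃[ b ] test (eq 15 1) σ ≡ b × Reflects X b

run-decider : ∀ c {k M X} → WP c k (Answers X) ([] , M) →
              ∃[ b ] ∃[ t ] decider c ▹ ⟪ 0 , (λ _ → num 0) , M ⟫ ⇓ b [ t ] × t ≤ k + 2 × Reflects X b
run-decider c (σ , m , run , m≤k , b , e , r) with AllAt-++⁻ (compile c 0) (length-compile c) (Code-self (decider c))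
... | code , rest = b , m + 2 , simulate run code (halts b σ rest e) (λ _ → num 0) (λ _ → refl) , ℕ.+-monoˡ-≤ 2 m≤k , r
  where
  halts : ∀ b σ → Code (decider c) (size c) (branch (eq 15 1) (2 + size c) ∷ halt false ∷ halt true ∷ []) →
          test (eq 15 1) σ ≡ b → Halts (decider c) (size c) σ b 2
  halts true  (vs , M) (f , _ , g , _) e = branch-halts f (vs , M) e (λ R _ → done g refl)
  halts false (vs , M) (f , g , _)     e = branch-halts f (vs , M) e (λ R _ → done g refl)

-- Symbol tests, the two logics, and marks

reflects-map : ∀ {P Q : Set} {b} → (P → Q) → (Q → P) → Reflects P b → Reflects Q b
reflects-map f g (ofʸ p)  = ofʸ (f p)
reflects-map f g (ofⁿ ¬p) = ofⁿ (λ q → ¬p (g q))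

reflects-≡ᵇ : ∀ m n → Reflects (m ≡ n) (m ≡ᵇ n)
reflects-≡ᵇ m n = proof (m ℕ.≟ n)

reflects-var : ∀ s p → Reflects (s ≡ var p) (s ==ˢ var p)
reflects-var (var q) p = reflects-map (cong var) (λ { refl → refl }) (reflects-≡ᵇ q p)
reflects-var (mod _) p = ofⁿ λ ()
reflects-var ⊤       p = ofⁿ λ ()
reflects-var lpar    p = ofⁿ λ ()
reflects-var ∧ˢ      p = ofⁿ λ ()
reflects-var rpar    p = ofⁿ λ ()
reflects-var ⊢       p = ofⁿ λ ()

reflects-mod : ∀ s β → Reflects (s ≡ mod β) (s ==ˢ mod β)
reflects-mod (mod α) β = reflects-map (cong mod) (λ { refl → refl }) (proof (α ≟ᵐ β))
reflects-mod (var _) p = ofⁿ λ ()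
reflects-mod ⊤       p = ofⁿ λ ()
reflects-mod lpar    p = ofⁿ λ ()
reflects-mod ∧ˢ      p = ofⁿ λ ()
reflects-mod rpar    p = ofⁿ λ ()
reflects-mod ⊢       p = ofⁿ λ ()

-- The comparison fails on symbols that are not modalities, so this one test decides whether a
-- position opens an edge > β.
reflects-<< : ∀ s β → Reflects (∃[ δ ] s ≡ mod δ × β <ᵐ δ) (sym (mod β) << sym s)
reflects-<< (mod α) β = reflects-map (λ l → α , refl , l) (λ { (_ , refl , l) → l }) (proof (β <ᵐ? α))
reflects-<< (var _) p = ofⁿ λ ()
reflects-<< ⊤       p = ofⁿ λ ()
reflects-<< lpar    p = ofⁿ λ ()
reflects-<< ∧ˢ      p = ofⁿ λ ()
reflects-<< rpar    p = ofⁿ λ ()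
reflects-<< ⊢       p = ofⁿ λ ()

bit : Bool → ℕ
bit true  = 1
bit false = 0

data Logic : Set where
  RJ RC : Logic

Hit : Logic → Rel Modality 0ℓ
Hit RJ = _≡_
Hit RC = _≤ᵐ_

Hit⇒≤ : ∀ L {β δ} → Hit L β δ → β ≤ᵐ δ
Hit⇒≤ RJ refl = ≤ᵐ-refl
Hit⇒≤ RC h    = h

Hit-refl : ∀ L {β} → Hit L β β
Hit-refl RJ = refl
Hit-refl RC = ≤ᵐ-refl

-- Whether a world forcing C can be reached downwards by edges ≥ β, without or with a hit.
data Mark : Set where
  none reach hit : Mark

-- Chosen so that a bit vector already is a vector of marks, with 1 read as `reach`; the upward
-- sweep needs no initialisation and works in place.
code : Mark → ℕ
code none  = 0
code reach = 1
code hit   = 2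

data _≼_ : Mark → Mark → Set where
  none≼ : ∀ {m} → none ≼ m
  same  : ∀ {m} → m ≼ m
  r≼h   : reach ≼ hit

≼-trans : ∀ {l m n} → l ≼ m → m ≼ n → l ≼ n
≼-trans none≼ _    = none≼
≼-trans same  q    = q
≼-trans r≼h   same = r≼h

≼hit : ∀ {m} → m ≼ hit
≼hit {none}  = none≼
≼hit {reach} = r≼h
≼hit {hit}   = same

-- The mark passed on along an edge > β, which is a hit only for RC.
climb : Logic → Mark → Mark
climb RJ m = m
climb RC m = hit

climb-sound : ∀ L m → β <ᵐ δ → climb L m ≡ m ⊎ climb L m ≡ hit × Hit L β δ
climb-sound RJ m l = inj₁ refl
climb-sound RC m l = inj₂ (refl , <ᵐ⇒≤ᵐ l)

climb-hit : ∀ L m → β <ᵐ δ → Hit L β δ → climb L m ≡ hit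
climb-hit RC m l h    = refl
climb-hit RJ m l refl = ⊥-elim (<ᵐ-irrefl l)

record Spells (M : ℕ → Value) (i : ℕ) (ss : List Symbol) : Set where
  constructor spells
  field at : ∀ k {s} → nth ss k ≡ just s → M (i + k) ≡ sym s
open Spells

module _ {M : ℕ → Value} where

  Spells-head : ∀ {s ss i} → Spells M i (s ∷ ss) → M i ≡ sym s
  Spells-head {i = i} sp = ≡.trans (cong M (≡.sym (ℕ.+-identityʳ i))) (at sp 0 refl)

  Spells-tail : ∀ {s ss i} → Spells M i (s ∷ ss) → Spells M (suc i) ss
  at (Spells-tail {i = i} sp) k e = ≡.trans (cong M (≡.sym (ℕ.+-suc i k))) (at sp (suc k) e)

  Spells-++ˡ : ∀ xs {ys i} → Spells M i (xs ++ ys) → Spells M i xs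
  at (Spells-++ˡ xs sp) k e = at sp k (nth-++ˡ xs {k = k} e)

  Spells-++ʳ : ∀ xs {ys i} → Spells M i (xs ++ ys) → Spells M (i + length xs) ys
  at (Spells-++ʳ xs {ys} {i} sp) k e =
    ≡.trans (cong M (ℕ.+-assoc i (length xs) k)) (at sp (length xs + k) (≡.trans (nth-++ xs {ys} {k}) e))

-- The program

record Temps : Set where
  constructor temps
  field
    y g a h z : Value

-- Registers: constants 0, 1, 2; n and n+1; the base w of the table of parent
-- worlds; the base p of the topmost bit vector; the position b and the
-- symbol x read in the word; constant symbols; a loop index i.
regs : (n w p b : ℕ) (x : Value) (i : ℕ) → Temps → List Value
regs n w p b x i τ =
  num 0 ∷ num 1 ∷ num 2 ∷ num n ∷ num (suc n) ∷ num w ∷ num p ∷ num b ∷ x ∷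
  sym ⊢ ∷ sym lpar ∷ sym ∧ˢ ∷ sym rpar ∷ sym ⊤ ∷ num i ∷ y ∷ g ∷ a ∷ h ∷ z ∷ []
  where open Temps τ

fill : Register → Cmd
fill r = block (const 14 (num 0) ∷ []) ⨾
         until (eq 14 4) (block (add 17 6 14 ∷ store 17 r ∷ add 14 1 14 ∷ []))

markVar : Cmd
markVar = block (const 14 (num 0) ∷ []) ⨾ until (eq 14 3)
  (block (load 15 14 ∷ []) ⨾
   cond (eq 15 8)
     (block (add 17 5 14 ∷ []) ⨾ block (load 19 17 ∷ []) ⨾ block (add 17 6 19 ∷ store 17 1 ∷ add 14 1 14 ∷ []))
     (block (add 14 1 14 ∷ [])))

-- The top vector is discarded, and the one below it is cleared wherever the discarded one has a 0.
intersect : Cmd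
intersect = block (sub 6 6 4 ∷ const 14 (num 0) ∷ []) ⨾ until (eq 14 4)
  (block (add 17 6 14 ∷ add 16 17 4 ∷ []) ⨾ block (load 15 16 ∷ []) ⨾
   cond (eq 15 0) (block (store 17 0 ∷ add 14 1 14 ∷ [])) (block (add 14 1 14 ∷ [])))

climbing : Logic → Cmd
climbing RJ = block []
climbing RC = block (const 16 (num 2) ∷ [])

-- Register 16 holds the mark to be passed to the parent. It is at least `reach`, so it may replace
-- every mark except `hit`.
raise : Cmd
raise = block (add 17 5 14 ∷ []) ⨾ block (load 19 17 ∷ []) ⨾ block (add 17 6 19 ∷ []) ⨾ block (load 18 17 ∷ []) ⨾
        cond (eq 18 2) skip (block (store 17 16 ∷ []))

sweepUp : Logic → Cmd
sweepUp L = block (move 14 3 ∷ []) ⨾ until (eq 14 0)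
  -- World i is opened by the symbol at position i - 1, hence the decrement between the two loads.
  (block (add 17 6 14 ∷ []) ⨾ block (load 16 17 ∷ []) ⨾ block (sub 14 14 1 ∷ []) ⨾ block (load 15 14 ∷ []) ⨾
   cond (eq 16 0) skip
     (cond (eq 15 8) (block (const 16 (num 2) ∷ []) ⨾ raise)
       (cond (lt 8 15) (climbing L ⨾ raise) skip)))

-- The caller presets register 16 to 0. The cell of the parent already contains a final bit, because
-- a parent has a smaller number than its child.
inherit : Cmd
inherit =
  cond (eq 18 2) (block (const 16 (num 1) ∷ []))
    (cond (eq 14 0) skip
      (block (sub 19 14 1 ∷ []) ⨾ block (load 15 19 ∷ []) ⨾
       cond (lt 8 15)
         (block (add 19 5 19 ∷ []) ⨾ block (load 19 19 ∷ []) ⨾ block (add 19 6 19 ∷ []) ⨾ block (load 16 19 ∷ []) ⨾ skip)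
         skip))

sweepDown : Cmd
sweepDown = block (const 14 (num 0) ∷ []) ⨾ until (eq 14 4)
  (block (add 17 6 14 ∷ const 16 (num 0) ∷ []) ⨾ block (load 18 17 ∷ []) ⨾
   inherit ⨾ block (store 17 16 ∷ add 14 1 14 ∷ []))

-- Read backwards, a modality follows its argument, and a conjunction is complete at its left
-- parenthesis, when both conjuncts have been pushed; the other two symbols of a conjunction require
-- no action.
process : Logic → Cmd
process L =
  cond (var 8) (block (add 6 6 4 ∷ []) ⨾ fill 0 ⨾ markVar)
  (cond (mod 8) (sweepUp L ⨾ sweepDown)
  (cond (eq 8 13) (block (add 6 6 4 ∷ []) ⨾ fill 1)
  (cond (eq 8 10) intersect skip)))

evaluate : Logic → Cmd
evaluate L = until (eq 8 9) (process L ⨾ block (sub 7 7 1 ∷ []) ⨾ block (load 8 7 ∷ []) ⨾ skip)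

scan : Test → Cmd
scan t = until t (block (add 14 1 14 ∷ []) ⨾ block (load 8 14 ∷ []) ⨾ skip)

setup : Cmd
setup =
  block (const 1 (num 1) ∷ const 2 (num 2) ∷ const 9 (sym ⊢) ∷ const 10 (sym lpar) ∷ const 11 (sym ∧ˢ) ∷
         -- `const 19` alters no register value but pads the list to its full length of 20.
         -- `load 8 14` reads cell 0, as register 14 is still 0.
         const 12 (sym rpar) ∷ const 13 (sym ⊤) ∷ const 19 (num 0) ∷ load 8 14 ∷ []) ⨾
  scan (eq 8 9) ⨾ block (move 3 14 ∷ add 4 1 14 ∷ []) ⨾
  -- The first cell holding a number ends the input and becomes the base `w`. The stack of worlds
  -- begins above the `n` cells of the table.
  scan (eq 8 0) ⨾ block (move 5 14 ∷ sub 7 14 1 ∷ add 6 14 3 ∷ const 14 (num 0) ∷ [])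

-- After a subformula register 16 may hold a world opened inside it; the next symbol, if any,
-- belongs to the enclosing conjunction, whose world is on the stack.
restore : Cmd
restore = cond (eq 15 11) (block (load 16 6 ∷ []) ⨾ skip)
            (cond (eq 15 12) (block (load 16 6 ∷ []) ⨾ block (sub 6 6 1 ∷ [])) skip)

advance : Cmd
advance = cond (mod 15) (block (add 16 1 14 ∷ add 14 1 14 ∷ []))
            (cond (eq 15 10) (block (add 6 1 6 ∷ store 6 16 ∷ add 14 1 14 ∷ [])) (block (add 14 1 14 ∷ [])))

-- Here register 6 points to the top of a stack of worlds and register 16 holds the current world.
parents : Cmd
parents = until (eq 14 3)
  (block (load 15 14 ∷ []) ⨾ restore ⨾ block (add 17 5 14 ∷ store 17 16 ∷ []) ⨾ advance)

main : Logic → Cmd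
-- `move 6 5` lets the table, padded to n + 1 cells, act as the bottom of the stack of bit vectors,
-- so the first vector is pushed just above it.
main L = setup ⨾ parents ⨾ block (move 6 5 ∷ []) ⨾ block (load 8 7 ∷ []) ⨾ evaluate L ⨾ block (load 15 6 ∷ []) ⨾ skip

program : Logic → Program
program L = decider (main L)

∣∧∣ : ∀ C D → ∣ C ∧ D ∣ ≡ 3 + (∣ C ∣ + ∣ D ∣)
∣∧∣ C D = ≡.trans (cong suc (≡.trans (length-++ (word C)) (cong (λ m → ∣ C ∣ + suc m) (length-++ (word D)))))
  (solve 2 (λ c d → con 1 :+ (c :+ (con 1 :+ (d :+ con 1))) := con 3 :+ (c :+ d)) refl ∣ C ∣ ∣ D ∣)

-- Correctness of the evaluator

module Eval (L : Logic) (A₀ : Formula) (w : ℕ) (M₀ : ℕ → Value)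
  (symAt : ∀ {k c} → nth (cells A₀ 0 0) k ≡ just c → M₀ k ≡ sym (proj₁ c))
  (parAt : ∀ {k c} → nth (cells A₀ 0 0) k ≡ just c → M₀ (w + k) ≡ num (proj₁ (proj₂ c)))
  (n≤w : ∣ A₀ ∣ ≤ w) where

  open Semantics (Hit L) (Hit⇒≤ L) A₀

  n : ℕ
  n = ∣ A₀ ∣

  -- Both directions are needed: `isVar⇒` and `isMod⇒` justify what the program writes, their
  -- converses ensure that no occurrence or edge is missed.
  record Node (k : ℕ) : Set where
    field
      s      : Symbol
      v      : ℕ
      s≡     : M₀ k ≡ sym s
      v≡     : M₀ (w + k) ≡ num v
      v≤k    : v ≤ k
      isVar⇒ : ∀ {q} → s ≡ var q → Occ A₀ (var q) v k
      isMod⇒ : ∀ {δ} → s ≡ mod δ → Edge v δ (suc k)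
      ⇒isVar : ∀ {q u} → Occ A₀ (var q) u k → s ≡ var q × u ≡ v
      ⇒isMod : ∀ {δ u} → Edge u δ (suc k) → s ≡ mod δ × u ≡ v

  node : ∀ k → k < n → Node k
  node k k<n with nth-< (cells A₀ 0 0) {k} (subst (k <_) (≡.sym (length-cells A₀ 0 0)) k<n)
  ... | c@(s , v , D) , e = record
    { s = s ; v = v ; s≡ = symAt e ; v≡ = parAt e
    ; v≤k = bound s desc
    ; isVar⇒ = λ { refl → proj₂ desc }
    ; isMod⇒ = λ { refl → k , _ , refl , proj₂ (proj₂ desc) }
    ; ⇒isVar = λ o → unique (≡.trans (≡.sym (Occ⇒nth o)) e)
    ; ⇒isMod = λ { (_ , _ , refl , o) → unique (≡.trans (≡.sym (Occ⇒nth o)) e) } }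
    where
    desc : Described A₀ k c
    desc = AllAt-nth (cells A₀ 0 0) (described A₀ here) k e
    bound : ∀ s → Described A₀ k (s , v , D) → v ≤ k
    bound (var _) (l , _) = l
    bound (mod _) (l , _) = l
    bound ⊤       l = l
    bound lpar    l = l
    bound ∧ˢ      l = l
    bound rpar    l = l
    bound ⊢       l = l
    unique : ∀ {s′ u E} → just (s′ , u , E) ≡ just (s , v , D) → s ≡ s′ × u ≡ v
    unique refl = refl , refl

  Occ⇒< : ∀ {A u k} → Occ A₀ A u k → k < n
  Occ⇒< o = subst (_ <_) (length-cells A₀ 0 0) (nth⇒< (cells A₀ 0 0) (Occ⇒nth o))

  Below : ℕ → (ℕ → Value) → (ℕ → Value) → Set
  Below p M M′ = ∀ j → j < p → M′ j ≡ M j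

  Below-≔ : ∀ {p M M′ a v} → Below p M M′ → p ≤ a → Below p M (M′ [ a ≔ v ])
  Below-≔ {M′ = M′} bl p≤a j j<p = ≡.trans (≔-other M′ (λ e → ℕ.<⇒≱ j<p (subst (_ ≤_) e p≤a))) (bl j j<p)

  Below-trans : ∀ {p q M M′ M″} → p ≤ q → Below p M M′ → Below q M′ M″ → Below p M M″
  Below-trans p≤q b b′ j j<p = ≡.trans (b′ j (ℕ.<-≤-trans j<p p≤q)) (b j j<p)

  -- A vector has a cell for every number up to n, including those that are not worlds.
  Bits : (ℕ → Value) → ℕ → (ℕ → Set) → Set
  Bits M p X = ∀ j → j ≤ n → ∃[ b ] M (p + j) ≡ num (bit b) × Reflects (X j) b

  Post : ℕ → ℕ → Value → ((ℕ → Value) → Set) → Store → Set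
  Post p b x K σ = ∃[ i ] ∃[ τ ] ∃[ M ] σ ≡ (regs n w p b x i τ , M) × K M

  Inv : ℕ → ℕ → Value → ℕ → ((ℕ → Value) → Set) → Store → Set
  Inv p b x i K σ = ∃[ τ ] ∃[ M ] σ ≡ (regs n w p b x i τ , M) × K M

  module _ {p b : ℕ} {x : Value} where

    wp-fill : ∀ {M i τ} r v → (∀ {i τ} → get (regs n w p b x i τ) r ≡ v) →
              WP (fill r) (suc (suc n * 5 + 1))
                 (Post p b x λ M′ → (∀ j → j ≤ n → M′ (p + j) ≡ v) × Below p M M′)
                 (regs n w p b x i τ , M)
    wp-fill {M} {i} {τ} r v r≡v = wp-⨾ (weakenWP ℕ.≤-refl
        (λ { (τ , M , e , f , g) → _ , τ , M , e , (λ j j≤n → f j (s≤s j≤n)) , g })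
        (wp-upto I (suc n) (λ { (_ , _ , refl , _) → ≡ᵇ-refl n }) step
          (_ , M , refl , (λ _ ()) , (λ _ _ → refl))))
      where
      I : ℕ → Store → Set
      I j = Inv p b x j λ M′ → (∀ l → l < j → M′ (p + l) ≡ v) × Below p M M′
      step : ∀ j {σ} → j < suc n → I j σ → test (eq 14 4) σ ≡ false ×
             WP (block (add 17 6 14 ∷ store 17 r ∷ add 14 1 14 ∷ [])) 3 (I (suc j)) σ
      step j j<n (τ , M′ , refl , f , g) = ≢⇒≡ᵇ (ℕ.<⇒≢ j<n) , wp-block (_ , _ , refl , f′ , Below-≔ {M = M} {M′} g (ℕ.m≤m+n p j))
        where
        v′ : Value
        v′ = get (regs n w p b x j (record τ { a = num (p + j) })) r
        f′ : ∀ l → l < suc j → (M′ [ p + j ≔ v′ ]) (p + l) ≡ v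
        f′ l (s≤s l≤j) with ℕ.m≤n⇒m<n∨m≡n l≤j
        ... | inj₁ l<j  = ≡.trans (≔-other M′ (λ e → ℕ.<⇒≢ l<j (≡.sym (ℕ.+-cancelˡ-≡ p _ _ e)))) (f l l<j)
        ... | inj₂ refl = ≡.trans (≔-same M′ (p + j)) (r≡v {j} {record τ { a = num (p + j) }})

  Bits-≔ : ∀ M p {X Y v b} → Bits M p X → (∀ l → l ≢ v → (X l → Y l) × (Y l → X l)) → Reflects (Y v) b →
           Bits (M [ p + v ≔ num (bit b) ]) p Y
  Bits-≔ M p {v = v} {b} f iff r l l≤n with v ℕ.≟ l
  ... | yes refl = b , ≔-same M (p + v) , r
  ... | no v≢l with f l l≤n | iff l (λ e → v≢l (≡.sym e))
  ...   | b′ , e , r′ | to , from = b′ , ≡.trans (≔-other M (λ e → v≢l (ℕ.+-cancelˡ-≡ p _ _ e))) e , reflects-map to from r′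

  Bits-map : ∀ M p {X Y} → Bits M p X → (∀ l → l ≤ n → (X l → Y l) × (Y l → X l)) → Bits M p Y
  Bits-map M p f iff l l≤n with f l l≤n | iff l l≤n
  ... | b , e , r | to , from = b , e , reflects-map to from r

  -- The end of the region kept during evaluation: the input and the table of parents, with one cell
  -- of padding.
  w⁺ : ℕ
  w⁺ = w + suc n

  ReadOnly : (ℕ → Value) → Set
  ReadOnly = Below w⁺ M₀

  read-s : ∀ {k M} → ReadOnly M → k < n → (nd : Node k) → M k ≡ sym (Node.s nd)
  read-s ro k<n nd = ≡.trans (ro _ (ℕ.<-≤-trans k<n (ℕ.≤-trans n≤w (ℕ.m≤m+n w _)))) (Node.s≡ nd)

  read-v : ∀ {k M} → ReadOnly M → k < n → (nd : Node k) → M (w + k) ≡ num (Node.v nd)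
  read-v ro k<n nd = ≡.trans (ro _ (ℕ.+-monoʳ-< w (ℕ.m<n⇒m<1+n k<n))) (Node.v≡ nd)

  module _ {p b : ℕ} (w⁺≤p : w⁺ ≤ p) where

    wp-markVar : ∀ {M i τ q} → ReadOnly M → (∀ j → j ≤ n → M (p + j) ≡ num 0) →
                 WP markVar (suc (n * 10 + 1))
                    (Post p b (sym (var q)) λ M′ → Bits M′ p (λ j → Force j (var q)) × Below p M M′)
                    (regs n w p b (sym (var q)) i τ , M)
    wp-markVar {M} {i} {τ} {q} ro zeros = wp-⨾ (weakenWP ℕ.≤-refl
        (λ { (τ , M , e , f , g) → _ , τ , M , e ,
             Bits-map M p f (λ l _ → (λ { (k , _ , o) → k , o }) , (λ { (k , o) → k , Occ⇒< o , o })) , g })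
        (wp-upto I n (λ { (_ , _ , refl , _) → ≡ᵇ-refl n }) step
          (_ , M , refl , (λ j j≤n → false , zeros j j≤n , ofⁿ λ ()) , (λ _ _ → refl))))
      where
      I : ℕ → Store → Set
      I j = Inv p b (sym (var q)) j λ M′ → Bits M′ p (λ l → ∃[ k ] k < j × Occ A₀ (var q) l k) × Below p M M′
      step : ∀ j {σ} → j < n → I j σ → test (eq 14 3) σ ≡ false × WP _ 8 (I (suc j)) σ
      step j j<n (τ , M′ , refl , f , g) = ≢⇒≡ᵇ (ℕ.<⇒≢ j<n) ,
        wp-load (read-s ro′ j<n nd) (wp-if (reflects-var s q)
          (λ e → wp-⨾ (wp-load (read-v ro′ j<n nd) (wp-block (_ , _ , refl ,
             Bits-≔ M′ p f (λ l l≢v → (λ { (k , k<j , o) → k , ℕ.m<n⇒m<1+n k<j , o }) ,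
                                 (λ { (k , k≤j , o) → k , earlier k≤j o (λ u≡v → l≢v u≡v) , o }))
                      (ofʸ (j , ℕ.n<1+n j , isVar⇒ e)) ,
             Below-≔ {M = M} {M′} g (ℕ.m≤m+n p v)))))
          (λ ¬e → wp-block (_ , _ , refl ,
             Bits-map M′ p f (λ l _ → (λ { (k , k<j , o) → k , ℕ.m<n⇒m<1+n k<j , o }) ,
                                 (λ { (k , k≤j , o) → k , earlier′ k≤j o ¬e , o })) , g)))
        where
        ro′ : ReadOnly M′
        ro′ = Below-trans {M = M₀} {M} {M′} w⁺≤p ro g
        nd : Node j
        nd = node j j<n
        open Node nd
        earlier : ∀ {k l} → k < suc j → Occ A₀ (var q) l k → l ≢ v → k < j
        earlier (s≤s k≤j) o l≢v with ℕ.m≤n⇒m<n∨m≡n k≤j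
        ... | inj₁ k<j  = k<j
        ... | inj₂ refl = ⊥-elim (l≢v (proj₂ (⇒isVar o)))
        earlier′ : ∀ {k l} → k < suc j → Occ A₀ (var q) l k → s ≢ var q → k < j
        earlier′ (s≤s k≤j) o ¬e with ℕ.m≤n⇒m<n∨m≡n k≤j
        ... | inj₁ k<j  = k<j
        ... | inj₂ refl = ⊥-elim (¬e (proj₁ (⇒isVar o)))

  reflects-≡ᵇ0 : ∀ {X : Set} {b} → Reflects X b → Reflects (¬ X) (bit b ≡ᵇ 0)
  reflects-≡ᵇ0 (ofʸ x)  = ofⁿ λ ¬x → ¬x x
  reflects-≡ᵇ0 (ofⁿ ¬x) = ofʸ ¬x

  wp-intersect : ∀ {p b x M i τ X Y} → Bits M p X → Bits M (p + suc n) Y →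
                 WP intersect (2 + (suc n * 9 + 1))
                    (Post p b x λ M′ → Bits M′ p (λ j → X j × Y j) × Below p M M′)
                    (regs n w (p + suc n) b x i τ , M)
  wp-intersect {p} {b} {x} {M} {i} {τ} {X} {Y} fX fY = wp-⨾ start
    where
    I : ℕ → Store → Set
    I j = Inv p b x j λ M′ → Bits M′ p (λ l → X l × (l < j → Y l)) ×
                             (∀ l → l ≤ n → M′ (p + suc n + l) ≡ M (p + suc n + l)) × Below p M M′
    step : ∀ j {σ} → j < suc n → I j σ → test (eq 14 4) σ ≡ false × WP _ 7 (I (suc j)) σ
    step j (s≤s j≤n) (τ , M′ , refl , f , up , g) with fY j j≤n
    ... | c , e , r = ≢⇒≡ᵇ (ℕ.<⇒≢ (s≤s j≤n)) ,
      wp-⨾ (wp-load (≡.trans (cong M′ addr) (≡.trans (up j j≤n) e)) (wp-if (reflects-≡ᵇ0 r)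
        (λ ¬y → wp-block (_ , _ , refl ,
           Bits-≔ M′ p {b = false} f (λ l l≢j → (λ { (x , h) → x , λ { (s≤s l≤j) → h (ℕ.≤∧≢⇒< l≤j l≢j) } }) ,
                              (λ { (x , h) → x , λ l<j → h (ℕ.m<n⇒m<1+n l<j) }))
                    (ofⁿ λ { (_ , h) → ¬y (h (ℕ.n<1+n j)) }) ,
           (λ l l≤n → ≡.trans (≔-other M′ (other l)) (up l l≤n)) ,
           Below-≔ {M = M} {M′} g (ℕ.m≤m+n p j)))
        (λ ¬¬y → wp-block (_ , _ , refl ,
           Bits-map M′ p f (λ l _ → (λ { (x , h) → x , λ { (s≤s l≤j) → new r ¬¬y h l≤j } }) ,
                               (λ { (x , h) → x , λ l<j → h (ℕ.m<n⇒m<1+n l<j) })) , up , g))))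
      where
      addr : p + j + suc n ≡ p + suc n + j
      addr = ≡.trans (ℕ.+-assoc p j _) (≡.trans (cong (p +_) (ℕ.+-comm j _)) (≡.sym (ℕ.+-assoc p _ j)))
      other : ∀ l → p + j ≢ p + suc n + l
      other l e = ℕ.<⇒≢ (ℕ.<-≤-trans (s≤s j≤n) (ℕ.m≤m+n (suc n) l)) (ℕ.+-cancelˡ-≡ p _ _ (≡.trans e (ℕ.+-assoc p _ l)))
      -- The failed test only refutes ¬ Y; the bit read from the upper vector decides Y itself.
      new : ∀ {l c} → Reflects (Y j) c → ¬ ¬ Y j → (l < j → Y l) → l ≤ j → Y l
      new r ¬¬y h l≤j with ℕ.m≤n⇒m<n∨m≡n l≤j
      ... | inj₁ l<j = h l<j
      new (ofʸ y)  ¬¬y h l≤j | inj₂ refl = y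
      new (ofⁿ ¬y) ¬¬y h l≤j | inj₂ refl = ⊥-elim (¬¬y ¬y)
    start : WP (until (eq 14 4) _) (suc n * 9 + 1) (Post p b x λ M′ → Bits M′ p (λ j → X j × Y j) × Below p M M′)
               (regs n w ((p + suc n) ∸ suc n) b x 0 τ , M)
    start rewrite ℕ.m+n∸n≡m p (suc n) = weakenWP ℕ.≤-refl
      (λ { (τ , M , e , f , _ , g) → _ , τ , M , e ,
           Bits-map M p f (λ l l≤n → (λ { (x , h) → x , h (s≤s l≤n) }) , (λ { (x , y) → x , λ _ → y })) , g })
      (wp-upto I (suc n) (λ { (_ , _ , refl , _) → ≡ᵇ-refl n }) step
        (_ , M , refl , Bits-map M p fX (λ l _ → (λ x → x , λ ()) , proj₁) , (λ _ _ → refl) , (λ _ _ → refl)))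

  -- Evaluating a modality by two sweeps

  Marks : (ℕ → Value) → ℕ → (ℕ → Mark) → Set
  Marks M p G = ∀ j → j ≤ n → M (p + j) ≡ num (code (G j))

  -- The mark `m` is only a lower bound at `v`, since a parent that is already `hit` stays as it is.
  Raised : ℕ → Mark → (ℕ → Mark) → (ℕ → Mark) → Set
  Raised v m G G′ = (∀ j → G j ≼ G′ j) × m ≼ G′ v × (∀ j → G′ j ≡ G j ⊎ j ≡ v × G′ j ≡ m)

  raised : ∀ G {v m} → reach ≼ m → G v ≢ hit → Raised v m G (λ j → if v ≡ᵇ j then m else G j)
  raised G {v} {m} r≼m ≢hit = grows , at-v , changes
    where
    below : ∀ g → g ≢ hit → g ≼ m
    below none  _ = none≼
    below reach _ = r≼m
    below hit   p = ⊥-elim (p refl)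
    grows : ∀ j → G j ≼ (if v ≡ᵇ j then m else G j)
    grows j with v ≡ᵇ j | reflects-≡ᵇ v j
    ... | true  | ofʸ refl = below (G v) ≢hit
    ... | false | _        = same
    at-v : m ≼ (if v ≡ᵇ v then m else G v)
    at-v rewrite ≡ᵇ-refl v = same
    changes : ∀ j → (if v ≡ᵇ j then m else G j) ≡ G j ⊎ j ≡ v × (if v ≡ᵇ j then m else G j) ≡ m
    changes j with v ≡ᵇ j | reflects-≡ᵇ v j
    ... | true  | ofʸ e = inj₂ (≡.sym e , refl)
    ... | false | _     = inj₁ refl

  Marks-≔ : ∀ M p {G v m} → Marks M p G → Marks (M [ p + v ≔ num (code m) ]) p (λ j → if v ≡ᵇ j then m else G j)
  Marks-≔ M p {v = v} f j j≤n with v ≡ᵇ j | reflects-≡ᵇ v j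
  ... | true  | ofʸ refl = ≔-same M (p + v)
  ... | false | ofⁿ v≢j  = ≡.trans (≔-other M (λ e → v≢j (ℕ.+-cancelˡ-≡ p _ _ e))) (f j j≤n)

  reflects-hit : ∀ g → Reflects (g ≡ hit) (code g ≡ᵇ 2)
  reflects-hit none  = ofⁿ λ ()
  reflects-hit reach = ofⁿ λ ()
  reflects-hit hit   = ofʸ refl

  wp-raise : ∀ {p b x k M y a h z G m} → ReadOnly M → (k<n : k < n) → Marks M p G → reach ≼ m →
             WP raise 7 (Inv p b x k λ M′ → Below p M M′ × ∃[ G′ ] Marks M′ p G′ × Raised (Node.v (node k k<n)) m G G′)
                (regs n w p b x k (temps y (num (code m)) a h z) , M)
  wp-raise {p} {M = M} {G = G} {m} ro k<n f r≼m =
    wp-⨾ (wp-load (read-v ro k<n nd) (wp-⨾ (wp-load (f v (ℕ.≤-trans v≤k (ℕ.<⇒≤ k<n))) (wp-if (reflects-hit (G v))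
      (λ e → wp-block (_ , _ , refl , (λ _ _ → refl) , G , f , (λ _ → same) , subst (m ≼_) (≡.sym e) ≼hit , (λ _ → inj₁ refl)))
      (λ ¬e → wp-block (_ , _ , refl , Below-≔ {M = M} {M} (λ _ _ → refl) (ℕ.m≤m+n p v) , _ , Marks-≔ M p f , raised G r≼m ¬e))))))
    where
    nd : Node _
    nd = node _ k<n
    open Node nd

  module _ (β : Modality) (X : ℕ → Set) where

    -- The positive content of a mark. `none` claims nothing: that a world is rightly unmarked
    -- follows from closure along the edges.
    Sem : Mark → ℕ → Set
    Sem none  j = 𝟙
    Sem reach j = ∃[ y ] Path (β ≤ᵐ_) j y × X y
    Sem hit   j = ∃[ y ] HitPath β j y × X y

    Flow : (ℕ → Mark) → ℕ → Modality → ℕ → Set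
    Flow G z δ c = (β ≤ᵐ δ → G c ≼ G z) × (Hit L β δ → reach ≼ G c → G z ≡ hit)

    -- Soundness of the marks (`sem`) holds throughout the sweep, whereas completeness is gained
    -- edge by edge: `closed` covers the edges into worlds > k.
    record Swept (k : ℕ) (G : ℕ → Mark) : Set where
      field
        sem     : ∀ j → Sem (G j) j
        closed  : ∀ l → k ≤ l → l < n → ∀ {z δ} → Edge z δ (suc l) → Flow G z δ (suc l)
        base    : ∀ j → j ≤ n → X j → reach ≼ G j
    open Swept

    swept-skip : ∀ {k G} → Swept (suc k) G → (∀ {z δ} → Edge z δ (suc k) → Flow G z δ (suc k)) → Swept k G
    swept-skip {k} {G} S flow = record { sem = sem S ; closed = closed′ ; base = base S }
      where
      closed′ : ∀ l → k ≤ l → l < n → ∀ {z δ} → Edge z δ (suc l) → Flow G z δ (suc l)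
      closed′ l k≤l l<n with ℕ.m≤n⇒m<n∨m≡n k≤l
      ... | inj₁ k<l  = closed S l k<l l<n
      ... | inj₂ refl = flow

    hit≼⇒≡ : ∀ {g} → hit ≼ g → g ≡ hit
    hit≼⇒≡ same = refl

    -- Only the mark of `v` changes, and v ≤ k, so `v` is not the lower end of any edge into a world
    -- > k. In the flow conditions settled so far only the upper mark can grow.
    swept-raise : ∀ {k G G′ v m} → Swept (suc k) G → Raised v m G G′ → v ≤ k → Sem m v →
                  (∀ {z δ} → Edge z δ (suc k) →
                     z ≡ v × (β ≤ᵐ δ → G (suc k) ≼ m) × (Hit L β δ → reach ≼ G (suc k) → m ≡ hit)) →
                  Swept k G′
    swept-raise {k} {G} {G′} {v} {m} S (grows , m≼ , changes) v≤k semv flow =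
      swept-skip (record { sem = sem′ ; closed = closed′ ; base = λ j j≤n x → ≼-trans (base S j j≤n x) (grows j) }) flow′
      where
      sem′ : ∀ j → Sem (G′ j) j
      sem′ j with changes j
      ... | inj₁ e          = subst (λ g → Sem g j) (≡.sym e) (sem S j)
      ... | inj₂ (refl , e) = subst (λ g → Sem g j) (≡.sym e) semv
      unchanged : ∀ l → k ≤ l → G′ (suc l) ≡ G (suc l)
      unchanged l k≤l with changes (suc l)
      ... | inj₁ e       = e
      ... | inj₂ (e , _) = ⊥-elim (ℕ.<⇒≢ (s≤s (ℕ.≤-trans v≤k k≤l)) (≡.sym e))
      closed′ : ∀ l → suc k ≤ l → l < n → ∀ {z δ} → Edge z δ (suc l) → Flow G′ z δ (suc l)
      closed′ l k<l l<n {z} e with closed S l k<l l<n e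
      ... | f , g rewrite unchanged l (ℕ.<⇒≤ k<l) =
        (λ β≤δ → ≼-trans (f β≤δ) (grows z)) , (λ h r → hit≼⇒≡ (subst (_≼ G′ z) (g h r) (grows z)))
      flow′ : ∀ {z δ} → Edge z δ (suc k) → Flow G′ z δ (suc k)
      flow′ e with flow e
      ... | refl , f , g rewrite unchanged k ℕ.≤-refl =
        (λ β≤δ → ≼-trans (f β≤δ) m≼) , (λ h r → hit≼⇒≡ (subst (_≼ G′ v) (g h r) m≼))

    Sem-hit : ∀ m {z δ c} → reach ≼ m → Edge z δ c → Hit L β δ → Sem m c → Sem hit z
    Sem-hit reach r e h (y , p , x) = y , (_ , _ , _ , [] , h , e , p) , x
    Sem-hit hit   r e h (y , p , x) = y , (_ , _ , _ , [] , h , e , forget p) , x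

    Sem-up : ∀ m {z δ c} → Edge z δ c → β ≤ᵐ δ → Sem m c → Sem m z
    Sem-up none  e l s = tt
    Sem-up reach e l (y , p , x) = y , ([] ▷ (l , e)) ⋈ p , x
    Sem-up hit   e l (y , p , x) = y , ([] ▷ (l , e)) ⋈ʰ p , x

    marks : ∀ M p → Bits M p X → ∃[ G ] Marks M p G × Swept n G
    marks M p f = G , marked , record
      { sem     = λ j → sem₀ j
      ; closed  = λ l n≤l l<n → ⊥-elim (ℕ.<⇒≱ l<n n≤l)
      ; base = λ j → base₀ j }
      where
      G : ℕ → Mark
      G j with j ℕ.≤? n
      ... | no _    = none
      ... | yes j≤n with f j j≤n
      ...   | true  , _ = reach
      ...   | false , _ = none
      marked : Marks M p G
      marked j j≤n with j ℕ.≤? n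
      ... | no j≰n   = ⊥-elim (j≰n j≤n)
      ... | yes j≤n′ with f j j≤n′
      ...   | true  , e , _ = e
      ...   | false , e , _ = e
      sem₀ : ∀ j → Sem (G j) j
      sem₀ j with j ℕ.≤? n
      ... | no _    = tt
      ... | yes j≤n with f j j≤n
      ...   | true  , _ , ofʸ x = j , [] , x
      ...   | false , _         = tt
      base₀ : ∀ j → j ≤ n → X j → reach ≼ G j
      base₀ j j≤n x with j ℕ.≤? n
      ... | no j≰n   = ⊥-elim (j≰n j≤n)
      ... | yes j≤n′ with f j j≤n′
      ...   | true  , _          = same
      ...   | false , _ , ofⁿ ¬x = ⊥-elim (¬x x)

    module _ {G} (S : Swept 0 G) where

      flow : ∀ {z δ c} → Edge z δ c → Flow G z δ c
      flow e@(_ , _ , refl , o) = closed S _ z≤n (Occ⇒< o) e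

      climbs : ∀ {z y} → Path (β ≤ᵐ_) z y → G y ≼ G z
      climbs []            = same
      climbs (p ▷ (l , e)) = ≼-trans (proj₁ (flow e) l) (climbs p)

      target≤n : ∀ {z y} {P : Modality → Set} → Path P z y → ∀ {u δ} → Edge u δ z → y ≤ n
      target≤n []                           (_ , _ , refl , o) = Occ⇒< o
      target≤n (p ▷ (_ , _ , _ , refl , o)) _                  = Occ⇒< o

      -- At least `reach` climbs from the witness to the lower end of the hit, the hit edge turns it
      -- into `hit`, and `hit` climbs the rest.
      hit-complete : ∀ {z} → (∃[ y ] HitPath β z y × X y) → G z ≡ hit
      hit-complete {z} (y , (u , δ , v , p , h , e , q) , x) = hit≼⇒≡
        (subst (_≼ G z) (proj₂ (flow e) h (≼-trans (base S y (target≤n q e) x) (climbs q))) (climbs p))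

      reflects-HitPath : ∀ z → Reflects (∃[ y ] HitPath β z y × X y) (code (G z) ≡ᵇ 2)
      reflects-HitPath z = reflects-map (λ e → subst (λ g → Sem g z) e (sem S z)) hit-complete (reflects-hit (G z))

    wp-sweepUp : ∀ {p b M i τ} → w⁺ ≤ p → ReadOnly M → Bits M p X →
                 WP (sweepUp L) (suc (n * 20 + 1))
                    (Post p b (sym (mod β)) λ M′ → Below p M M′ × ∃[ G ] Marks M′ p G × Swept 0 G)
                    (regs n w p b (sym (mod β)) i τ , M)
    wp-sweepUp {p} {b} {M} {i} {τ} w⁺≤p ro f with marks M p f
    ... | G₀ , marked₀ , S₀ = wp-⨾ (weakenWP ℕ.≤-refl (λ { (τ , M , e , _ , k) → _ , τ , M , e , k })
        (wp-downto I (λ { (_ , _ , refl , _) → refl }) step n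
          (_ , M , refl , ℕ.≤-refl , (λ _ _ → refl) , G₀ , marked₀ , S₀)))
      where
      I : ℕ → Store → Set
      I k = Inv p b (sym (mod β)) k λ M′ → k ≤ n × Below p M M′ × ∃[ G ] Marks M′ p G × Swept k G
      step : ∀ k {σ} → I (suc k) σ → test (eq 14 0) σ ≡ false × WP _ 18 (I k) σ
      step k (τ , M′ , refl , k<n , bl , G , marked , S) = refl ,
        wp-⨾ (wp-load (marked (suc k) k<n) (wp-⨾ (wp-load (read-s ro′ k<n nd) (rest (G (suc k)) refl))))
        where
        ro′ : ReadOnly M′
        ro′ = Below-trans {M = M₀} {M} {M′} w⁺≤p ro bl
        nd : Node k
        nd = node k k<n
        open Node nd
        finish : ∀ {m σ} → Sem m v → (∀ {z δ} → Edge z δ (suc k) →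
                   z ≡ v × (β ≤ᵐ δ → G (suc k) ≼ m) × (Hit L β δ → reach ≼ G (suc k) → m ≡ hit)) →
                 Inv p b (sym (mod β)) k (λ M″ → Below p M′ M″ × ∃[ G′ ] Marks M″ p G′ × Raised v m G G′) σ → I k σ
        finish s fl (τ , M″ , e , bl′ , G′ , marked′ , R) =
          τ , M″ , e , ℕ.<⇒≤ k<n , Below-trans {M = M} {M′} {M″} ℕ.≤-refl bl bl′ , G′ , marked′ , swept-raise S R v≤k s fl
        stay : ∀ {τ} → (∀ {z δ} → Edge z δ (suc k) → Flow G z δ (suc k)) →
               WP skip 0 (I k) (regs n w p b (sym (mod β)) k τ , M′)
        stay fl = wp-block (_ , M′ , refl , ℕ.<⇒≤ k<n , bl , G , marked , swept-skip S fl)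
        climbing-raise : ∀ L′ {y a h z m} → reach ≼ m →
          WP (climbing L′ ⨾ raise) 8 (Inv p b (sym (mod β)) k (λ M″ → Below p M′ M″ × ∃[ G′ ] Marks M″ p G′ × Raised v (climb L′ m) G G′))
             (regs n w p b (sym (mod β)) k (temps y (num (code m)) a h z) , M′)
        climbing-raise RJ r = weakenWP (ℕ.n≤1+n 7) (λ q → q) (wp-⨾ (wp-raise {b = b} {sym (mod β)} {M = M′} ro′ k<n marked r))
        climbing-raise RC r = wp-⨾ (wp-raise {b = b} {sym (mod β)} {M = M′} {m = hit} ro′ k<n marked r≼h)
        parent : ∀ {z δ ε} → s ≡ mod ε → Edge z δ (suc k) → z ≡ v × δ ≡ ε
        parent s≡ε e with ⇒isMod e
        ... | s≡δ , z≡v with ≡.trans (≡.sym s≡δ) s≡ε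
        ...   | refl = z≡v , refl
        active : ∀ {a h z} m → G (suc k) ≡ m → reach ≼ m →
                 WP (cond (eq 15 8) (block (const 16 (num 2) ∷ []) ⨾ raise) (cond (lt 8 15) (climbing L ⨾ raise) skip)) 12 (I k)
                    (regs n w p b (sym (mod β)) k (temps (sym s) (num (code m)) a h z) , M′)
        active m refl r = wp-if (reflects-mod s β)
          (λ s≡β → wp-⨾ (weakenWP ℕ.≤-refl
             (finish (Sem-hit m r (isMod⇒ s≡β) (Hit-refl L) (sem S (suc k)))
                     (λ e → proj₁ (parent s≡β e) , (λ _ → ≼hit) , (λ _ _ → refl)))
             (wp-raise {b = b} {sym (mod β)} {M = M′} {m = hit} ro′ k<n marked r≼h)))
          (λ s≢β → wp-if (reflects-<< s β)
             (λ { (δ , s≡δ , β<δ) → weakenWP ℕ.≤-refl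
                    (finish (climbed β<δ (isMod⇒ s≡δ) (climb-sound L m β<δ))
                            (λ e → proj₁ (parent s≡δ e) , (λ _ → m≼climb (climb-sound L m β<δ)) ,
                                   (λ h _ → climb-hit L m (subst (β <ᵐ_) (≡.sym (proj₂ (parent s≡δ e))) β<δ) h)))
                    (climbing-raise L r) })
             -- A label that is neither β nor above it is not ≥ β, so both flow conditions are
             -- vacuous.
             (λ ¬lt → stay (λ e → (λ β≤δ → ⊥-elim (too-low s≢β ¬lt e β≤δ)) , (λ h _ → ⊥-elim (too-low s≢β ¬lt e (Hit⇒≤ L h))))))
          where
          climbed : ∀ {δ} → β <ᵐ δ → Edge v δ (suc k) → climb L m ≡ m ⊎ climb L m ≡ hit × Hit L β δ → Sem (climb L m) v
          climbed β<δ e (inj₁ eq′)       = subst (λ g → Sem g v) (≡.sym eq′) (Sem-up m e (<ᵐ⇒≤ᵐ β<δ) (sem S (suc k)))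
          climbed β<δ e (inj₂ (eq′ , h)) = subst (λ g → Sem g v) (≡.sym eq′) (Sem-hit m r e h (sem S (suc k)))
          m≼climb : ∀ {P : Set} → climb L m ≡ m ⊎ climb L m ≡ hit × P → m ≼ climb L m
          m≼climb (inj₁ eq′)       = subst (m ≼_) (≡.sym eq′) same
          m≼climb (inj₂ (eq′ , _)) = subst (m ≼_) (≡.sym eq′) ≼hit
          too-low : s ≢ mod β → ¬ (∃[ δ ] s ≡ mod δ × β <ᵐ δ) → ∀ {z δ} → Edge z δ (suc k) → ¬ (β ≤ᵐ δ)
          too-low s≢β ¬lt e β≤δ with ≤ᵐ⇒<ᵐ⊎≡ β≤δ
          ... | inj₁ β<δ  = ¬lt (_ , proj₁ (⇒isMod e) , β<δ)
          ... | inj₂ refl = s≢β (proj₁ (⇒isMod e))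
        rest : ∀ {a h z} m → G (suc k) ≡ m →
               WP (cond (eq 16 0) skip
                     (cond (eq 15 8) (block (const 16 (num 2) ∷ []) ⨾ raise) (cond (lt 8 15) (climbing L ⨾ raise) skip))) 14 (I k)
                  (regs n w p b (sym (mod β)) k (temps (sym s) (num (code m)) a h z) , M′)
        rest none  e = wp-if {m = 0} {12} (ofʸ tt) (λ _ → stay (λ {z} _ →
                         (λ _ → subst (_≼ G z) (≡.sym e) none≼) , (λ _ r → ⊥-elim (¬r≼none (subst (reach ≼_) e r)))))
                         (λ ¬t → ⊥-elim (¬t tt))
          where
          ¬r≼none : ¬ (reach ≼ none)
          ¬r≼none ()
        rest reach e = wp-if {P = ⊥} {m = 0} (ofⁿ λ x → x) (λ ()) (λ _ → active reach e same)
        rest hit   e = wp-if {P = ⊥} {m = 0} (ofⁿ λ x → x) (λ ()) (λ _ → active hit e r≼h)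

    Above : ℕ → Set
    Above j = ∃[ y ] Acc β j y × X y

    -- An access from `j` either starts its hit path at `j`, which the mark decides, or descends to
    -- `j` by a last edge > β; without that edge it is an access from the parent, whose bit is
    -- already known.
    wp-inherit : ∀ {p b M j y z G} → w⁺ ≤ p → ReadOnly M → Swept 0 G → j ≤ n →
                 (∀ l → l < j → ∃[ c ] M (p + l) ≡ num (bit c) × Reflects (Above l) c) →
                 WP inherit 12
                    (λ σ → ∃[ c ] ∃[ y ] ∃[ z ] σ ≡ (regs n w p b (sym (mod β)) j (temps y (num (bit c)) (num (p + j)) (num (code (G j))) z) , M)
                                                × Reflects (Above j) c)
                    (regs n w p b (sym (mod β)) j (temps y (num 0) (num (p + j)) (num (code (G j))) z) , M)
    wp-inherit {p} {b} {M} {zero} {G = G} w⁺≤p ro S j≤n f = weakenWP (ℕ.m≤m+n 5 7) (λ q → q)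
      (wp-if {m = 1} {3} (reflects-HitPath S 0)
        (λ { (y , h , x) → wp-block (true , _ , _ , refl , ofʸ (y , (_ , [] , h) , x)) })
        (λ ¬h → weakenWP (ℕ.m≤m+n 2 1) (λ q → q) (wp-if {m = 0} {0} (ofʸ tt)
          (λ _ → wp-block (false , _ , _ , refl , ofⁿ λ { (y , (_ , [] , h) , x) → ¬h (y , h , x)
                                                        ; (y , (_ , (_ ▷ (_ , _ , _ , () , _)) , _) , _) }))
          (λ ¬t → ⊥-elim (¬t tt)))))
    wp-inherit {p} {b} {M} {suc k} {G = G} w⁺≤p ro S k<n f =
      wp-if {m = 1} (reflects-HitPath S (suc k))
        (λ { (y , h , x) → wp-block (true , _ , _ , refl , ofʸ (y , (_ , [] , h) , x)) })
        (λ ¬h → wp-if {P = ⊥} {m = 0} (ofⁿ λ x → x) (λ ()) λ _ →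
          wp-⨾ (wp-load (read-s ro k<n nd) (wp-if (reflects-<< s β)
            (λ { (δ , s≡δ , β<δ) → fetched ¬h s≡δ β<δ (f v (s≤s v≤k)) })
            (λ ¬lt → wp-block (false , _ , _ , refl , ofⁿ λ
              { (y , (_ , [] , h) , x) → ¬h (y , h , x)
              ; (y , (_ , (_ ▷ (β<δ , e)) , _) , _) → ¬lt (_ , proj₁ (⇒isMod e) , β<δ) })))))
      where
      nd : Node k
      nd = node k k<n
      open Node nd
      fetched : ∀ {δ y a h} → ¬ (∃[ y ] HitPath β (suc k) y × X y) → s ≡ mod δ → β <ᵐ δ →
        ∃[ c ] M (p + v) ≡ num (bit c) × Reflects (Above v) c →
        WP (block (add 19 5 19 ∷ []) ⨾ block (load 19 19 ∷ []) ⨾ block (add 19 6 19 ∷ []) ⨾ block (load 16 19 ∷ []) ⨾ skip) 4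
           (λ σ → ∃[ c ] ∃[ y ] ∃[ z ] σ ≡ (regs n w p b (sym (mod β)) (suc k) (temps y (num (bit c)) a h z) , M)
                                     × Reflects (Above (suc k)) c)
           (regs n w p b (sym (mod β)) (suc k) (temps y (num 0) a h (num k)) , M)
      fetched {δ} ¬h s≡δ β<δ (c , e , r) = wp-⨾ (wp-load (read-v ro k<n nd) (wp-⨾ (wp-load e (wp-block (c , _ , _ , refl ,
        reflects-map (λ { (y , (z , p , h) , x) → y , (z , p ▷ (β<δ , isMod⇒ s≡δ) , h) , x }) from r)))))
        where
        from : Above (suc k) → Above v
        from (y , (_ , [] , h) , x) = ⊥-elim (¬h (y , h , x))
        from (y , (z , (p ▷ (l , e)) , h) , x) with proj₂ (⇒isMod e)
        ... | refl = y , (z , p , h) , x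

    wp-sweepDown : ∀ {p b M i τ G} → w⁺ ≤ p → ReadOnly M → Marks M p G → Swept 0 G →
                   WP sweepDown (suc (suc n * 19 + 1))
                      (Post p b (sym (mod β)) λ M′ → Bits M′ p Above × Below p M M′)
                      (regs n w p b (sym (mod β)) i τ , M)
    wp-sweepDown {p} {b} {M} {i} {τ} {G} w⁺≤p ro marked S = wp-⨾ (weakenWP ℕ.≤-refl
        (λ { (τ , M , e , f , _ , g) → _ , τ , M , e , (λ l l≤n → f l (s≤s l≤n)) , g })
        (wp-upto I (suc n) (λ { (_ , _ , refl , _) → ≡ᵇ-refl n }) step
          (_ , M , refl , (λ _ ()) , (λ l _ → marked l) , (λ _ _ → refl))))
      where
      I : ℕ → Store → Set
      -- One vector holds both: final bits before `j`, and from `j` on the marks still to be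
      -- consumed.
      I j = Inv p b (sym (mod β)) j λ M′ →
        (∀ l → l < j → ∃[ c ] M′ (p + l) ≡ num (bit c) × Reflects (Above l) c) ×
        (∀ l → j ≤ l → l ≤ n → M′ (p + l) ≡ num (code (G l))) × Below p M M′
      step : ∀ j {σ} → j < suc n → I j σ → test (eq 14 4) σ ≡ false × WP _ 17 (I (suc j)) σ
      step j (s≤s j≤n) (τ , M′ , refl , f , g , bl) = ≢⇒≡ᵇ (ℕ.<⇒≢ (s≤s j≤n)) ,
        wp-⨾ (wp-load (g j ℕ.≤-refl j≤n) (wp-inherit {b = b} w⁺≤p (Below-trans {M = M₀} {M} {M′} w⁺≤p ro bl) S j≤n f
          then λ { (c , _ , _ , refl , r) → wp-block (_ , _ , refl , f′ c r , g′ c , Below-≔ {M = M} {M′} bl (ℕ.m≤m+n p j)) }))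
        where
        elsewhere : ∀ {c l} → j ≢ l → (M′ [ p + j ≔ num (bit c) ]) (p + l) ≡ M′ (p + l)
        elsewhere j≢l = ≔-other M′ (λ e → j≢l (ℕ.+-cancelˡ-≡ p _ _ e))
        f′ : ∀ c → Reflects (Above j) c → ∀ l → l < suc j →
             ∃[ c′ ] (M′ [ p + j ≔ num (bit c) ]) (p + l) ≡ num (bit c′) × Reflects (Above l) c′
        f′ c r l (s≤s l≤j) with ℕ.m≤n⇒m<n∨m≡n l≤j
        ... | inj₂ refl = c , ≔-same M′ (p + j) , r
        ... | inj₁ l<j with f l l<j
        ...   | c′ , e , r′ = c′ , ≡.trans (elsewhere (λ e → ℕ.<⇒≢ l<j (≡.sym e))) e , r′
        g′ : ∀ c l → suc j ≤ l → l ≤ n → (M′ [ p + j ≔ num (bit c) ]) (p + l) ≡ num (code (G l))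
        g′ c l j<l l≤n = ≡.trans (elsewhere (ℕ.<⇒≢ j<l)) (g l (ℕ.<⇒≤ j<l) l≤n)

  -- The run over the tested formula from right to left

  symbolCost : ℕ
  symbolCost = 80 * suc n

  -- Constants are absorbed because n + 1 ≥ 1. The most expensive symbol is a modality, with a + b =
  -- 46; the 4 steps for loop control and the next symbol fit into the remaining 6 of the 80 units.
  linear : ∀ a b {c} → c ≡ a + b * suc n → a + b ≤ 74 → c ≤ 74 * suc n
  linear a b {c} refl le = begin
    a + b * suc n           ≤⟨ ℕ.+-monoˡ-≤ (b * suc n) (ℕ.m≤m*n a (suc n)) ⟩
    a * suc n + b * suc n   ≡⟨ ℕ.*-distribʳ-+ (suc n) a b ⟨
    (a + b) * suc n         ≤⟨ ℕ.*-monoˡ-≤ (suc n) le ⟩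
    74 * suc n              ∎
    where open ℕ.≤-Reasoning

  step : ∀ {p b s i τ M t Q p′} (X : (ℕ → Value) → Set) → (s ==ˢ ⊢) ≡ false → suc b < w → (∀ {M′} → X M′ → ReadOnly M′) →
    WP (process L) (74 * suc n) (Post p′ (suc b) (sym s) X) (regs n w p (suc b) (sym s) i τ , M) →
    (∀ {i τ M′} → X M′ → WP (evaluate L) t Q (regs n w p′ b (M₀ b) i τ , M′)) →
    WP (evaluate L) (symbolCost + t) Q (regs n w p (suc b) (sym s) i τ , M)
  step {b = b} {t = t} X s≢⊢ b<w ro wp k = weakenWP cost (λ q → q) (wp-again s≢⊢
      (wp then λ { (i , τ , M′ , refl , x) → wp-⨾ (wp-load (ro x b below) (wp-block (k x))) }))
    where
    below : b < w⁺
    below = ℕ.≤-trans (ℕ.<⇒≤ b<w) (ℕ.m≤m+n w _)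
    cost : 2 + (74 * suc n + 2) + t ≤ symbolCost + t
    cost = ℕ.+-monoˡ-≤ t (begin
      2 + (74 * suc n + 2)      ≡⟨ solve 1 (λ m → con 2 :+ (con 74 :* m :+ con 2) := con 4 :+ con 74 :* m) refl (suc n) ⟩
      4 + 74 * suc n            ≤⟨ ℕ.+-monoˡ-≤ (74 * suc n) (ℕ.≤-trans (ℕ.m≤m*n 4 (suc n)) (ℕ.*-monoˡ-≤ (suc n) (ℕ.m≤m+n 4 2))) ⟩
      6 * suc n + 74 * suc n    ≡⟨ ℕ.*-distribʳ-+ (suc n) 6 74 ⟨
      symbolCost                         ∎)
      where open ℕ.≤-Reasoning

  private variable
    t : ℕ
    Q : Store → Set

  -- The evaluator is one flat loop in which the recursion on formulas leaves no trace. A formula is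
  -- therefore specified by what it hands to the remaining rounds of the loop.
  Continuation : ℕ → ℕ → ((ℕ → Value) → Set) → ℕ → (Store → Set) → Set
  Continuation p o X t Q = ∀ {i τ M} → X M → WP (evaluate L) t Q (regs n w p o (M₀ o) i τ , M)

  Pushed : Formula → ℕ → (ℕ → Value) → (ℕ → Value) → Set
  Pushed C p M M′ = Bits M′ p (λ j → Force j C) × Below p M M′

  readOnly : ∀ {p M M′} → w ≤ p → ReadOnly M → Below (p + suc n) M M′ → ReadOnly M′
  readOnly {M = M} {M′} w≤p ro bl = Below-trans {M = M₀} {M} {M′} (ℕ.+-monoˡ-≤ (suc n) w≤p) ro bl

  eval-var : ∀ q {o p i τ M} → suc o < w → w ≤ p → ReadOnly M →
             Continuation (p + suc n) o (Pushed (var q) (p + suc n) M) t Q →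
             WP (evaluate L) (symbolCost + t) Q (regs n w p (suc o) (sym (var q)) i τ , M)
  eval-var q {o} {p} {M = M} o<w w≤p ro = step (Pushed (var q) (p + suc n) M) refl o<w (λ x → readOnly {M = M} w≤p ro (proj₂ x))
    (weakenWP cost (λ x → x) (wp-true refl (wp-⨾ (wp-fill 0 (num 0) refl then
      λ { (i , τ , M′ , refl , zeros , bl) →
          weakenWP ℕ.≤-refl
            (λ { (i , τ , M″ , e , f , bl′) → i , τ , M″ , e , f , Below-trans {M = M} {M′} {M″} ℕ.≤-refl bl bl′ })
            (wp-markVar (ℕ.+-monoˡ-≤ (suc n) w≤p) (readOnly {M = M} w≤p ro bl) zeros) }))))
    where
    cost : suc (1 + (suc (suc n * 5 + 1) + suc (n * 10 + 1))) ≤ 74 * suc n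
    cost = ℕ.≤-trans (ℕ.+-monoʳ-≤ 2 (ℕ.+-monoʳ-≤ (suc (suc n * 5 + 1)) (s≤s (ℕ.+-monoˡ-≤ 1 (ℕ.*-monoˡ-≤ 10 (ℕ.n≤1+n n))))))
      (linear 6 15 (solve 1 (λ m → con 2 :+ (con 1 :+ (m :* con 5 :+ con 1) :+ (con 1 :+ (m :* con 10 :+ con 1))) := con 6 :+ con 15 :* m) refl (suc n))
        (ℕ.m≤m+n 21 53))

  eval-⊤ : ∀ {o p i τ M} → suc o < w → w ≤ p → ReadOnly M →
           Continuation (p + suc n) o (Pushed ⊤ (p + suc n) M) t Q →
           WP (evaluate L) (symbolCost + t) Q (regs n w p (suc o) (sym ⊤) i τ , M)
  eval-⊤ {o = o} {p} {M = M} o<w w≤p ro = step (Pushed ⊤ (p + suc n) M) refl o<w (λ x → readOnly {M = M} w≤p ro (proj₂ x))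
    (weakenWP cost (λ x → x) (wp-false refl (wp-false refl (wp-true refl (wp-⨾ (weakenWP ℕ.≤-refl
      (λ { (i , τ , M′ , e , ones , bl) → i , τ , M′ , e , (λ j j≤n → true , ones j j≤n , ofʸ tt) , bl })
      (wp-fill 1 (num 1) refl)))))))
    where
    cost : 2 + (2 + suc (1 + suc (suc n * 5 + 1))) ≤ 74 * suc n
    cost = linear 8 5 (solve 1 (λ m → con 7 :+ (m :* con 5 :+ con 1) := con 8 :+ con 5 :* m) refl (suc n)) (ℕ.m≤m+n 13 61)

  eval-mod : ∀ β C {o p i τ M M′} → suc o < w → w ≤ p → ReadOnly M → Pushed C (p + suc n) M M′ →
             Continuation (p + suc n) o (Pushed (⟨ β ⟩ C) (p + suc n) M) t Q →
             WP (evaluate L) (symbolCost + t) Q (regs n w (p + suc n) (suc o) (sym (mod β)) i τ , M′)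
  eval-mod β C {o} {p} {M = M} {M′} o<w w≤p ro (f , bl) = step (Pushed (⟨ β ⟩ C) (p + suc n) M) refl o<w
    (λ x → readOnly {M = M} w≤p ro (proj₂ x))
    (weakenWP cost (λ x → x) (wp-false refl (wp-true refl
      (wp-sweepUp β (λ j → Force j C) w⁺≤ ro′ f then
       λ { (i , τ , M″ , refl , bl′ , G , marked , S) → weakenWP ℕ.≤-refl
             (λ { (i , τ , M‴ , e , f , bl″) → i , τ , M‴ , e , f ,
                  Below-trans {M = M} {M′} {M‴} ℕ.≤-refl bl (Below-trans {M = M′} {M″} {M‴} ℕ.≤-refl bl′ bl″) })
             (wp-sweepDown β (λ j → Force j C) w⁺≤ (Below-trans {M = M₀} {M′} {M″} w⁺≤ ro′ bl′) marked S) }))))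
    where
    w⁺≤ : w⁺ ≤ p + suc n
    w⁺≤ = ℕ.+-monoˡ-≤ (suc n) w≤p
    ro′ : ReadOnly M′
    ro′ = readOnly {M = M} w≤p ro bl
    cost : 2 + suc (suc (n * 20 + 1) + suc (suc n * 19 + 1)) ≤ 74 * suc n
    cost = ℕ.≤-trans (ℕ.+-monoʳ-≤ 4 (ℕ.+-monoˡ-≤ (suc (suc n * 19 + 1)) (ℕ.+-monoˡ-≤ 1 (ℕ.*-monoˡ-≤ 20 (ℕ.n≤1+n n)))))
      (linear 7 39 (solve 1 (λ m → con 4 :+ (m :* con 20 :+ con 1 :+ (con 1 :+ (m :* con 19 :+ con 1))) := con 7 :+ con 39 :* m) refl (suc n))
        (ℕ.m≤m+n 46 28))

  eval-lpar : ∀ C D {o p i τ M M′ M″} → suc o < w → w ≤ p → ReadOnly M →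
              Pushed D (p + suc n) M M′ → Pushed C (p + suc n + suc n) M′ M″ →
              Continuation (p + suc n) o (Pushed (C ∧ D) (p + suc n) M) t Q →
              WP (evaluate L) (symbolCost + t) Q (regs n w (p + suc n + suc n) (suc o) (sym lpar) i τ , M″)
  eval-lpar C D {o} {p} {M = M} {M′} {M″} o<w w≤p ro (fD , bl) (fC , bl′) = step (Pushed (C ∧ D) (p + suc n) M) refl o<w
    (λ x → readOnly {M = M} w≤p ro (proj₂ x))
    (weakenWP cost (λ x → x) (wp-false refl (wp-false refl (wp-false refl (wp-true refl (weakenWP ℕ.≤-refl
      (λ { (i , τ , M‴ , e , f , bl″) → i , τ , M‴ , e ,
           Bits-map M‴ (p + suc n) f (λ _ _ → (λ { (d , c) → c , d }) , (λ { (c , d) → d , c })) ,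
           Below-trans {M = M} {M′} {M‴} ℕ.≤-refl bl
             (Below-trans {M = M′} {M″} {M‴} ℕ.≤-refl (λ j j<p → bl′ j (ℕ.<-≤-trans j<p (ℕ.m≤m+n _ (suc n)))) bl″) })
      (wp-intersect fD′ fC)))))))
    where
    fD′ : Bits M″ (p + suc n) (λ j → Force j D)
    fD′ j j≤n with fD j j≤n
    ... | b , e , r = b , ≡.trans (bl′ _ (ℕ.+-monoʳ-< (p + suc n) (s≤s j≤n))) e , r
    cost : 2 + (2 + (2 + suc (2 + (suc n * 9 + 1)))) ≤ 74 * suc n
    cost = linear 10 9 (solve 1 (λ m → con 9 :+ (m :* con 9 :+ con 1) := con 10 :+ con 9 :* m) refl (suc n)) (ℕ.m≤m+n 19 55)

  skipping : ∀ {p b s i τ M} → s ≡ ∧ˢ ⊎ s ≡ rpar → suc b < w → ReadOnly M →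
             Continuation p b (_≡ M) t Q →
             WP (evaluate L) (symbolCost + t) Q (regs n w p (suc b) (sym s) i τ , M)
  skipping {M = M} s b<w ro = skip-step s
    where
    cost : 8 ≤ 74 * suc n
    cost = linear 8 0 refl (ℕ.m≤m+n 8 66)
    skip-step : ∀ {p s i τ} → s ≡ ∧ˢ ⊎ s ≡ rpar → Continuation p _ (_≡ M) _ _ → WP (evaluate L) _ _ (regs n w p (suc _) (sym s) i τ , M)
    skip-step (inj₁ refl) = step (_≡ M) refl b<w (λ { refl → ro })
      (weakenWP cost (λ x → x) (wp-false refl (wp-false refl (wp-false refl (wp-false refl (wp-block (_ , _ , M , refl , refl)))))))
    skip-step (inj₂ refl) = step (_≡ M) refl b<w (λ { refl → ro })
      (weakenWP cost (λ x → x) (wp-false refl (wp-false refl (wp-false refl (wp-false refl (wp-block (_ , _ , M , refl , refl)))))))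

  reading : ∀ {p b x i τ M} → M₀ b ≡ x → WP (evaluate L) t Q (regs n w p b x i τ , M) →
            WP (evaluate L) t Q (regs n w p b (M₀ b) i τ , M)
  reading refl wp = wp

  reading-at : ∀ {p b b′ i τ M} → b ≡ b′ → WP (evaluate L) t Q (regs n w p b′ (M₀ b′) i τ , M) →
               WP (evaluate L) t Q (regs n w p b (M₀ b) i τ , M)
  reading-at refl wp = wp

  -- The formula occupies the positions from o + 1 to o + ∣ C ∣; it is entered at its last symbol
  -- and left at `o`.
  eval : ∀ C {o p i τ M} → Spells M₀ (suc o) (word C) → o + ∣ C ∣ < w → w ≤ p → ReadOnly M →
         Continuation (p + suc n) o (Pushed C (p + suc n) M) t Q →
         WP (evaluate L) (∣ C ∣ * symbolCost + t) Q (regs n w p (o + ∣ C ∣) (M₀ (o + ∣ C ∣)) i τ , M)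
  eval {t} (var q) {o} seg lt′ w≤p ro k rewrite ℕ.+-comm o 1 | Spells-head seg =
    weakenWP (ℕ.≤-reflexive (cong (_+ t) (≡.sym (ℕ.+-identityʳ symbolCost)))) (λ x → x) (eval-var q lt′ w≤p ro k)
  eval {t} ⊤       {o} seg lt′ w≤p ro k rewrite ℕ.+-comm o 1 | Spells-head seg =
    weakenWP (ℕ.≤-reflexive (cong (_+ t) (≡.sym (ℕ.+-identityʳ symbolCost)))) (λ x → x) (eval-⊤ lt′ w≤p ro k)
  eval {t} {Q} (⟨ β ⟩ C) {o} {p} {i} {τ} {M} seg lt′ w≤p ro k rewrite ℕ.+-suc o ∣ C ∣ =
    weakenWP (ℕ.≤-reflexive cost) (λ x → x) (eval C (Spells-tail seg) lt′ w≤p ro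
      (λ pushed → reading (Spells-head seg) (eval-mod β C (ℕ.≤-<-trans (ℕ.m≤m+n _ ∣ C ∣) lt′) w≤p ro pushed k)))
    where
    cost : ∣ C ∣ * symbolCost + (symbolCost + t) ≡ symbolCost + ∣ C ∣ * symbolCost + t
    cost = solve 3 (λ c k t → c :* k :+ (k :+ t) := k :+ c :* k :+ t) refl ∣ C ∣ symbolCost t
  eval {t} {Q} (C ∧ D) {o} {p} {i} {τ} {M} seg lt′ w≤p ro k =
    -- The symbols arrive in the order right parenthesis, D, ∧, C, left parenthesis, so the vector
    -- of C ends up on top of that of D.
    reading-at end (reading (Spells-head seg₄)
      (weakenWP (ℕ.≤-reflexive cost) (λ x → x)
       (skipping (inj₂ refl) end<w ro λ { refl →
        eval D segD oD<w w≤p ro λ pushedD →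
        let ro′ = readOnly {M = M} w≤p ro (proj₂ pushedD) in
        reading (Spells-head seg₂)
        (skipping (inj₁ refl) (ℕ.≤-<-trans (ℕ.m≤m+n oD ∣ D ∣) oD<w) ro′ λ { refl →
         eval C (Spells-++ˡ (word C) seg₁) (ℕ.<-trans (ℕ.n<1+n _) (ℕ.≤-<-trans (ℕ.m≤m+n oD ∣ D ∣) oD<w))
           (ℕ.≤-trans w≤p (ℕ.m≤m+n p _)) ro′ λ pushedC →
         reading (Spells-head seg)
         (eval-lpar C D (ℕ.<-trans (s≤s (s≤s (ℕ.m≤m+n o (∣ C ∣ + ∣ D ∣)))) small) w≤p ro pushedD pushedC k) }) })))
    where
    oD : ℕ
    oD = suc (suc o + ∣ C ∣)
    seg₁ : Spells M₀ (suc (suc o)) (word C ++ ∧ˢ ∷ word D ++ rpar ∷ [])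
    seg₁ = Spells-tail seg
    seg₂ : Spells M₀ (suc (suc o + ∣ C ∣)) (∧ˢ ∷ word D ++ rpar ∷ [])
    seg₂ = Spells-++ʳ (word C) seg₁
    seg₃ : Spells M₀ (suc oD) (word D ++ rpar ∷ [])
    seg₃ = Spells-tail seg₂
    segD : Spells M₀ (suc oD) (word D)
    segD = Spells-++ˡ (word D) seg₃
    seg₄ : Spells M₀ (suc (oD + ∣ D ∣)) (rpar ∷ [])
    seg₄ = Spells-++ʳ (word D) seg₃
    len : ∣ C ∧ D ∣ ≡ 3 + (∣ C ∣ + ∣ D ∣)
    len = ∣∧∣ C D
    end : o + ∣ C ∧ D ∣ ≡ suc (oD + ∣ D ∣)
    end = ≡.trans (cong (o +_) len) (solve 3 (λ o c d → o :+ (con 3 :+ (c :+ d)) := con 3 :+ (o :+ c :+ d)) refl o ∣ C ∣ ∣ D ∣)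
    end<w : suc (oD + ∣ D ∣) < w
    end<w = subst (_< w) end lt′
    oD<w : oD + ∣ D ∣ < w
    oD<w = ℕ.<-trans (ℕ.n<1+n _) end<w
    small : suc (suc (o + (∣ C ∣ + ∣ D ∣))) < w
    small = subst (λ m → suc (suc m) < w) (ℕ.+-assoc o ∣ C ∣ ∣ D ∣) oD<w
    cost : symbolCost + (∣ D ∣ * symbolCost + (symbolCost + (∣ C ∣ * symbolCost + (symbolCost + t)))) ≡ ∣ C ∧ D ∣ * symbolCost + t
    cost = ≡.trans (solve 4 (λ c d k t → k :+ (d :* k :+ (k :+ (c :* k :+ (k :+ t)))) := (con 3 :+ (c :+ d)) :* k :+ t) refl ∣ C ∣ ∣ D ∣ symbolCost t)
                   (cong (λ m → m * symbolCost + t) (≡.sym len))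

-- Correctness of the input phase

no-⊢ : ∀ A → All (λ s → (s ==ˢ ⊢) ≡ false) (word A)
no-⊢ (var p)   = refl ∷ []
no-⊢ ⊤         = refl ∷ []
no-⊢ (A ∧ B)   = refl ∷ ++⁺ (no-⊢ A) (refl ∷ ++⁺ (no-⊢ B) (refl ∷ []))
no-⊢ (⟨ α ⟩ A) = refl ∷ no-⊢ A

module Input (A B : Formula) where

  n w : ℕ
  n = ∣ A ∣
  w = suc ∣ B ∣ + n

  input : List Symbol
  input = word A ++ ⊢ ∷ word B

  M₁ : ℕ → Value
  M₁ i = maybe′ sym (num 0) (nth input i)

  M₁-A : ∀ {k s} → nth (word A) k ≡ just s → M₁ k ≡ sym s
  M₁-A {k} e = cong (maybe′ sym (num 0)) (nth-++ˡ (word A) {k = k} e)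

  M₁-B : ∀ {k s} → nth (⊢ ∷ word B) k ≡ just s → M₁ (n + k) ≡ sym s
  M₁-B {k} e = cong (maybe′ sym (num 0)) (≡.trans (nth-++ (word A) {⊢ ∷ word B} {k}) e)

  temps₀ : Temps
  temps₀ = temps (num 0) (num 0) (num 0) (num 0) (num 0)

  -- While the input is scanned, registers 3 and 4 are not yet set to n and n + 1, so unlike in
  -- `regs` they are independent.
  raw : (n s w p b : ℕ) (x : Value) (i : ℕ) → List Value
  raw n s w p b x i =
    num 0 ∷ num 1 ∷ num 2 ∷ num n ∷ num s ∷ num w ∷ num p ∷ num b ∷ x ∷
    sym ⊢ ∷ sym lpar ∷ sym ∧ˢ ∷ sym rpar ∷ sym ⊤ ∷ num i ∷ num 0 ∷ num 0 ∷ num 0 ∷ num 0 ∷ num 0 ∷ []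

  wp-scan : ∀ {t n′ s k j₀} → test t (raw n′ s 0 0 0 (M₁ (k + j₀)) (k + j₀) , M₁) ≡ true →
            (∀ j → j < k → test t (raw n′ s 0 0 0 (M₁ (j + j₀)) (j + j₀) , M₁) ≡ false) →
            WP (scan t) (k * 4 + 1) (_≡ (raw n′ s 0 0 0 (M₁ (k + j₀)) (k + j₀) , M₁)) (raw n′ s 0 0 0 (M₁ j₀) j₀ , M₁)
  wp-scan {t} {n′} {s} {k} {j₀} stop go = wp-upto (λ j → _≡ (raw n′ s 0 0 0 (M₁ (j + j₀)) (j + j₀) , M₁)) k
    (λ { refl → stop }) (λ { j j<k refl → go j j<k , wp-⨾ (wp-load refl (wp-block refl)) }) refl

  wp-setup : WP setup (9 + (n * 4 + 1 + (2 + (suc ∣ B ∣ * 4 + 1 + 4))))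
                (_≡ (regs n w (w + n) (∣ B ∣ + n) (M₁ w) 0 temps₀ , M₁)) ([] , M₁)
  wp-setup = wp-⨾ (wp-scan {k = n} {0} stop₁ go₁ then λ { refl → wp-⨾ (scan₂ then λ { refl → wp-block refl }) })
    where
    stop₁ : (M₁ (n + 0) == sym ⊢) ≡ true
    stop₁ = cong (_== sym ⊢) (M₁-B {0} refl)
    go₁ : ∀ j → j < n → (M₁ (j + 0) == sym ⊢) ≡ false
    go₁ j j<n rewrite ℕ.+-identityʳ j with nth-< (word A) j<n
    ... | s , e = ≡.trans (cong (_== sym ⊢) (M₁-A {j} e)) (nth-All (no-⊢ A) j e)
    stop₂ : (M₁ w == num 0) ≡ true
    stop₂ = cong (λ m → maybe′ sym (num 0) m == num 0)
      (≡.trans (cong (nth input) (ℕ.+-comm (suc ∣ B ∣) n)) (≡.trans (nth-++ (word A) {⊢ ∷ word B} {suc ∣ B ∣}) (nth-length (word B))))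
    go₂ : ∀ j → j < suc ∣ B ∣ → (M₁ (j + n) == num 0) ≡ false
    go₂ j j<m rewrite ℕ.+-comm j n with nth-< (⊢ ∷ word B) j<m
    ... | s , e = cong (_== num 0) (M₁-B {j} e)
    scan₂ : WP (scan (eq 8 0)) (suc ∣ B ∣ * 4 + 1) (_≡ (raw n (suc n) 0 0 0 (M₁ w) w , M₁))
               (raw (n + 0) (suc (n + 0)) 0 0 0 (M₁ (n + 0)) (n + 0) , M₁)
    scan₂ rewrite ℕ.+-identityʳ n = wp-scan {k = suc ∣ B ∣} {n} stop₂ go₂

  -- The two regions a subformula starting at position i must respect: the input with the earlier
  -- part of the table, and the part of the stack of worlds in use.
  Untouched : ℕ → ℕ → (ℕ → Value) → (ℕ → Value) → Set
  Untouched i sp M M′ = (∀ j → j < w + i → M′ j ≡ M j) × (∀ j → w + n ≤ j → j ≤ sp → M′ j ≡ M j)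

  Untouched-trans : ∀ {i i′ sp M M′ M″} → Untouched i sp M M′ → i ≤ i′ → Untouched i′ sp M′ M″ → Untouched i sp M M″
  Untouched-trans (f , g) i≤i′ (f′ , g′) =
    (λ j lt′ → ≡.trans (f′ j (ℕ.<-≤-trans lt′ (ℕ.+-monoʳ-≤ w i≤i′))) (f j lt′)) ,
    (λ j l u → ≡.trans (g′ j l u) (g j l u))

  Untouched-≔ : ∀ M {i sp v} → i < n → Untouched i sp M (M [ w + i ≔ v ])
  Untouched-≔ M {i} i<n = (λ j lt′ → ≔-other M (λ e → ℕ.<⇒≢ lt′ (≡.sym e))) ,
                          (λ j l _ → ≔-other M (ℕ.<⇒≢ (ℕ.<-≤-trans (ℕ.+-monoʳ-< w i<n) l)))

  Table : (ℕ → Value) → ℕ → List Cell → Set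
  Table M = AllAt (λ k c → M (w + k) ≡ num (proj₁ (proj₂ c)))

  Table-keep : ∀ {M M′ i} xs {m} → (∀ j → j < w + m → M′ j ≡ M j) → i + length xs ≤ m → Table M i xs → Table M′ i xs
  Table-keep []       keep le t       = tt
  Table-keep {i = i} (x ∷ xs) {m} keep le (e , t) =
    ≡.trans (keep _ (ℕ.+-monoʳ-< w (ℕ.<-≤-trans (ℕ.m<m+n i (s≤s z≤n)) le))) e ,
    Table-keep xs {m} keep (subst (_≤ m) (ℕ.+-suc i (length xs)) le) t

  private variable
    t : ℕ
    Q : Store → Set

  InputOK : (ℕ → Value) → Set
  InputOK M = ∀ j → j < w → M j ≡ M₁ j

  InputOK-Untouched : ∀ {i sp M M′} → InputOK M → Untouched i sp M M′ → InputOK M′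
  InputOK-Untouched {i} ok (f , _) j j<w = ≡.trans (f j (ℕ.<-≤-trans j<w (ℕ.m≤m+n w i))) (ok j j<w)

  n≤w : n ≤ w
  n≤w = ℕ.m≤n+m n (suc ∣ B ∣)

  -- 2 steps for loop control, 1 for loading the symbol, and at most 12 for handling it.
  visitCost : ℕ
  visitCost = 15

  data Atomic : Symbol → Set where
    var : ∀ p → Atomic (var p)
    ⊤   : Atomic ⊤

  Visited : Formula → (wd i sp : ℕ) → (ℕ → Value) → (ℕ → Value) → Set
  Visited C wd i sp M M′ = Table M′ i (cells C wd i) × Untouched i sp M M′

  module _ {b : ℕ} {x : Value} where

    visit-symbol : ∀ {s i sp y g h a z M} → i < n → InputOK M → M₁ i ≡ sym s →
      WP (restore ⨾ block (add 17 5 14 ∷ store 17 16 ∷ []) ⨾ advance) 12 (WP parents t Q)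
         (regs n w sp b x i (temps (sym s) g a h z) , M) →
      WP parents (visitCost + t) Q (regs n w sp b x i (temps y g a h z) , M)
    visit-symbol i<n ok e wp =
      wp-again (≢⇒≡ᵇ (ℕ.<⇒≢ i<n)) (wp-load (≡.trans (ok _ (ℕ.<-≤-trans i<n n≤w)) e) wp)

    visit-atom : ∀ {s i sp y wd h a z M} → Atomic s → i < n → InputOK M → M₁ i ≡ sym s →
      (∀ {τ} → WP parents t Q (regs n w sp b x (suc i) τ , M [ w + i ≔ num wd ])) →
      WP parents (visitCost + t) Q (regs n w sp b x i (temps y (num wd) a h z) , M)
    visit-atom (var p) i<n ok e k = visit-symbol i<n ok e (weakenWP (ℕ.n≤1+n 11) (λ q → q)
      (wp-false refl (wp-false refl (wp-block refl)) then≡ wp-⨾ (wp-false refl (wp-false refl (wp-block k)))))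
    visit-atom ⊤ i<n ok e k = visit-symbol i<n ok e (weakenWP (ℕ.n≤1+n 11) (λ q → q)
      (wp-false refl (wp-false refl (wp-block refl)) then≡ wp-⨾ (wp-false refl (wp-false refl (wp-block k)))))

    visit-mod : ∀ {δ i sp y wd h a z M} → i < n → InputOK M → M₁ i ≡ sym (mod δ) →
      (∀ {y a h z} → WP parents t Q (regs n w sp b x (suc i) (temps y (num (suc i)) a h z) , M [ w + i ≔ num wd ])) →
      WP parents (visitCost + t) Q (regs n w sp b x i (temps y (num wd) a h z) , M)
    visit-mod i<n ok e k = visit-symbol i<n ok e (weakenWP (ℕ.m≤m+n 9 3) (λ q → q)
      (wp-false refl (wp-false refl (wp-block refl)) then≡ wp-⨾ (wp-true refl (wp-block k))))

    visit-lpar : ∀ {i sp y wd h a z M} → i < n → InputOK M → M₁ i ≡ sym lpar →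
      (∀ {y a h z} → WP parents t Q (regs n w (suc sp) b x (suc i) (temps y (num wd) a h z) ,
                                   (M [ w + i ≔ num wd ]) [ suc sp ≔ num wd ])) →
      WP parents (visitCost + t) Q (regs n w sp b x i (temps y (num wd) a h z) , M)
    visit-lpar i<n ok e k = visit-symbol i<n ok e
      (wp-false refl (wp-false refl (wp-block refl)) then≡ wp-⨾ (wp-false refl (wp-true refl (wp-block k))))

    visit-∧ : ∀ {i sp y g wd h a z M} → i < n → InputOK M → M₁ i ≡ sym ∧ˢ → M sp ≡ num wd →
      (∀ {y a h z} → WP parents t Q (regs n w sp b x (suc i) (temps y (num wd) a h z) , M [ w + i ≔ num wd ])) →
      WP parents (visitCost + t) Q (regs n w sp b x i (temps y g a h z) , M)
    visit-∧ i<n ok e e′ k = visit-symbol i<n ok e (weakenWP (ℕ.m≤m+n 9 3) (λ q → q)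
      (wp-true refl (wp-load e′ (wp-block refl)) then≡ wp-⨾ (wp-false refl (wp-false refl (wp-block k)))))

    visit-rpar : ∀ {i sp y g wd h a z M} → i < n → InputOK M → M₁ i ≡ sym rpar → M (suc sp) ≡ num wd →
      (∀ {τ} → WP parents t Q (regs n w sp b x (suc i) τ , M [ w + i ≔ num wd ])) →
      WP parents (visitCost + t) Q (regs n w (suc sp) b x i (temps y g a h z) , M)
    visit-rpar i<n ok e e′ k = visit-symbol i<n ok e
      (wp-false refl (wp-true refl (wp-load e′ (wp-block refl))) then≡ wp-⨾ (wp-false refl (wp-false refl (wp-block k))))

    visiting : ∀ {i j sp τ M} → i ≡ j → WP parents t Q (regs n w sp b x i τ , M) → WP parents t Q (regs n w sp b x j τ , M)
    visiting refl wp = wp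

    -- The continuation must accept arbitrary temporaries: the current world is lost inside C, and
    -- the symbol after C reloads it from the stack, unless the word ends.
    visit : ∀ C {i wd sp y a h z M} → Spells M₁ i (word C) → i + ∣ C ∣ ≤ n → w + n ≤ sp → InputOK M →
      (∀ {τ M′} → Visited C wd i sp M M′ → WP parents t Q (regs n w sp b x (i + ∣ C ∣) τ , M′)) →
      WP parents (∣ C ∣ * visitCost + t) Q (regs n w sp b x i (temps y (num wd) a h z) , M)
    visit (var p) {i} {M = M} seg le l ok k =
      let i<n = subst (_≤ n) (ℕ.+-comm i 1) le in
      visit-atom (var p) i<n ok (Spells-head seg)
        (visiting (ℕ.+-comm i 1) (k ((≔-same M (w + i) , tt) , Untouched-≔ M i<n)))
    visit ⊤ {i} {M = M} seg le l ok k =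
      let i<n = subst (_≤ n) (ℕ.+-comm i 1) le in
      visit-atom ⊤ i<n ok (Spells-head seg)
        (visiting (ℕ.+-comm i 1) (k ((≔-same M (w + i) , tt) , Untouched-≔ M i<n)))
    visit {t} (⟨ δ ⟩ C) {i} {wd} {sp} {M = M} seg le l ok k =
      let le′ = subst (_≤ n) (ℕ.+-suc i ∣ C ∣) le
          i<n = ℕ.≤-trans (ℕ.m≤m+n (suc i) ∣ C ∣) le′
          un  = Untouched-≔ M {i} {sp} i<n
      in weakenWP (ℕ.≤-reflexive (≡.sym (ℕ.+-assoc visitCost (∣ C ∣ * visitCost) t))) (λ q → q)
        (visit-mod i<n ok (Spells-head seg)
          (visit C (Spells-tail seg) le′ l (InputOK-Untouched {i} {sp} {M} ok un) λ { {τ} {M′} (table , un′) →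
            visiting (ℕ.+-suc i ∣ C ∣) (k ((≡.trans (proj₁ un′ (w + i) (ℕ.+-monoʳ-< w (ℕ.n<1+n i))) (≔-same M (w + i)) , table) ,
                                          Untouched-trans {i} {suc i} {sp} {M} un (ℕ.n≤1+n i) un′)) }))
    visit {t} {Q} (C ∧ D) {i} {wd} {sp} {M = M} seg le l ok k =
      weakenWP (ℕ.≤-reflexive cost) (λ q → q)
      (visit-lpar i<n ok (Spells-head seg)
       (visit C (Spells-++ˡ (word C) seg₁) (ℕ.≤-trans (ℕ.n≤1+n i′) i′<n) (ℕ.m≤n⇒m≤1+n l) (InputOK-Untouched {i} {sp} {M} ok un₁)
        λ { {τ} {M₃} (tableC , un₂) →
        -- The world pushed at the left parenthesis survives C, as cells up to the stack pointer are
        -- preserved.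
        let top₃ = ≡.trans (proj₂ un₂ (suc sp) (ℕ.m≤n⇒m≤1+n l) ℕ.≤-refl) (≔-same M₂ (suc sp))
            ok₃  = InputOK-Untouched {suc i} {suc sp} {M₂′} (InputOK-Untouched {i} {sp} {M} ok un₁) un₂
            M₄   = M₃ [ w + i′ ≔ num wd ]
            un₃  = Untouched-≔ M₃ {i′} {suc sp} i′<n
        in visit-∧ i′<n ok₃ (Spells-head seg₂) top₃
         (visit D (Spells-++ˡ (word D) seg₃) (ℕ.<⇒≤ i″<n) (ℕ.m≤n⇒m≤1+n l) (InputOK-Untouched {i′} {suc sp} {M₃} ok₃ un₃)
          λ { {τ} {M₅} (tableD , un₄) →
          let ok₅  = InputOK-Untouched {suc i′} {suc sp} {M₄} (InputOK-Untouched {i′} {suc sp} {M₃} ok₃ un₃) un₄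
              un₃₄ = Untouched-trans {i′} {suc i′} {suc sp} {M₃} {M₄} un₃ (ℕ.n≤1+n i′) un₄
              top₅ = ≡.trans (proj₂ un₃₄ (suc sp) (ℕ.m≤n⇒m≤1+n l) ℕ.≤-refl) top₃
          in visit-rpar i″<n ok₅ (Spells-head seg₄) top₅ (visiting end (k (finish tableC un₂ tableD un₃ un₄))) }) }))
      where
      i′ i″ : ℕ
      i′ = suc i + ∣ C ∣
      i″ = suc i′ + ∣ D ∣
      M₂ M₂′ : ℕ → Value
      M₂  = M [ w + i ≔ num wd ]
      M₂′ = M₂ [ suc sp ≔ num wd ]
      seg₁ : Spells M₁ (suc i) (word C ++ ∧ˢ ∷ word D ++ rpar ∷ [])
      seg₁ = Spells-tail seg
      seg₂ : Spells M₁ i′ (∧ˢ ∷ word D ++ rpar ∷ [])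
      seg₂ = Spells-++ʳ (word C) seg₁
      seg₃ : Spells M₁ (suc i′) (word D ++ rpar ∷ [])
      seg₃ = Spells-tail seg₂
      seg₄ : Spells M₁ i″ (rpar ∷ [])
      seg₄ = Spells-++ʳ (word D) seg₃
      end : i + ∣ C ∧ D ∣ ≡ suc i″
      end = ≡.trans (cong (i +_) (∣∧∣ C D)) (solve 3 (λ o c d → o :+ (con 3 :+ (c :+ d)) := con 3 :+ (o :+ c :+ d)) refl i ∣ C ∣ ∣ D ∣)
      i″<n : i″ < n
      i″<n = subst (_≤ n) end le
      i′<n : i′ < n
      i′<n = ℕ.<-trans (ℕ.m≤m+n (suc i′) ∣ D ∣) i″<n
      i<n : i < n
      i<n = ℕ.<-trans (ℕ.m≤m+n (suc i) ∣ C ∣) i′<n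
      far : ∀ {j} → j < w + n → suc sp ≢ j
      far j<w+n e = ℕ.<⇒≢ (ℕ.<-≤-trans j<w+n (ℕ.m≤n⇒m≤1+n l)) (≡.sym e)
      un₁ : Untouched i sp M M₂′
      un₁ = (λ j lt′ → ≡.trans (≔-other M₂ (far (ℕ.<-trans lt′ (ℕ.+-monoʳ-< w i<n)))) (proj₁ (Untouched-≔ M {i} {sp} i<n) j lt′)) ,
            (λ j l u → ≡.trans (≔-other M₂ (λ e → ℕ.<⇒≢ (s≤s u) (≡.sym e))) (proj₂ (Untouched-≔ M {i} {sp} i<n) j l u))
      finish : ∀ {M₃ M₅} → Table M₃ (suc i) (cells C wd (suc i)) → Untouched (suc i) (suc sp) M₂′ M₃ →
               Table M₅ (suc i′) (cells D wd (suc i′)) →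
               Untouched i′ (suc sp) M₃ (M₃ [ w + i′ ≔ num wd ]) → Untouched (suc i′) (suc sp) (M₃ [ w + i′ ≔ num wd ]) M₅ →
               Visited (C ∧ D) wd i sp M (M₅ [ w + i″ ≔ num wd ])
      finish {M₃} {M₅} tableC un₂ tableD un₃ un₄ =
        (≡.trans (proj₁ un₂₅ (w + i) (ℕ.+-monoʳ-< w (ℕ.n<1+n i))) (≡.trans (≔-other M₂ (far (ℕ.+-monoʳ-< w i<n))) (≔-same M (w + i))) ,
         AllAt-++ (cells C wd (suc i)) (length-cells C wd (suc i))
           (Table-keep (cells C wd (suc i)) {i′} (proj₁ un₃₅) (ℕ.≤-reflexive (cong (suc i +_) (length-cells C wd (suc i)))) tableC)
           (≡.trans (proj₁ un₄₅ (w + i′) (ℕ.+-monoʳ-< w (ℕ.n<1+n i′))) (≔-same M₃ (w + i′)) ,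
            AllAt-++ (cells D wd (suc i′)) (length-cells D wd (suc i′))
              (Table-keep (cells D wd (suc i′)) {i″} (proj₁ un₅) (ℕ.≤-reflexive (cong (suc i′ +_) (length-cells D wd (suc i′)))) tableD)
              (≔-same M₅ (w + i″) , tt))) ,
        Untouched-trans {i} {suc i} {sp} {M} {M₂′} un₁ (ℕ.n≤1+n i) (proj₁ un₂₅ , λ j l u → proj₂ un₂₅ j l (ℕ.m≤n⇒m≤1+n u))
        where
        M₄ M₆ : ℕ → Value
        M₄ = M₃ [ w + i′ ≔ num wd ]
        M₆ = M₅ [ w + i″ ≔ num wd ]
        un₅ : Untouched i″ (suc sp) M₅ M₆
        un₅ = Untouched-≔ M₅ i″<n
        un₄₅ : Untouched (suc i′) (suc sp) M₄ M₆
        un₄₅ = Untouched-trans {suc i′} {i″} {suc sp} {M₄} {M₅} {M₆} un₄ (ℕ.m≤m+n (suc i′) ∣ D ∣) un₅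
        un₃₅ : Untouched i′ (suc sp) M₃ M₆
        un₃₅ = Untouched-trans {i′} {suc i′} {suc sp} {M₃} {M₄} {M₆} un₃ (ℕ.n≤1+n i′) un₄₅
        un₂₅ : Untouched (suc i) (suc sp) M₂′ M₆
        un₂₅ = Untouched-trans {suc i} {i′} {suc sp} {M₂′} {M₃} {M₆} un₂ (ℕ.m≤m+n (suc i) ∣ C ∣) un₃₅
      cost : visitCost + (∣ C ∣ * visitCost + (visitCost + (∣ D ∣ * visitCost + (visitCost + t)))) ≡ ∣ C ∧ D ∣ * visitCost + t
      cost = ≡.trans (solve 4 (λ c d k t → k :+ (c :* k :+ (k :+ (d :* k :+ (k :+ t)))) := (con 3 :+ (c :+ d)) :* k :+ t) refl ∣ C ∣ ∣ D ∣ visitCost t)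
                     (cong (λ m → m * visitCost + t) (≡.sym (∣∧∣ C D)))

  wp-parents : ∀ {b x τ} → Temps.g τ ≡ num 0 →
               WP parents (n * visitCost + 1)
                  (λ σ → ∃[ τ ] ∃[ M ] σ ≡ (regs n w (w + n) b x n τ , M) × Visited A 0 0 (w + n) M₁ M)
                  (regs n w (w + n) b x 0 τ , M₁)
  wp-parents {τ = temps _ _ _ _ _} refl = visit A (spells λ k e → M₁-A {k} e) ℕ.≤-refl ℕ.≤-refl (λ _ _ → refl)
    (λ {τ} {M} v → wp-exit (≡ᵇ-refl n) (τ , M , refl , v))

  module _ (L : Logic) where
    open Semantics (Hit L) (Hit⇒≤ L) A using (Force)

    symbolCost : ℕ
    symbolCost = 80 * suc n

    wp-answer : ∀ {i τ M} → Visited A 0 0 (w + n) M₁ M →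
                WP (evaluate L ⨾ block (load 15 6 ∷ []) ⨾ skip) (∣ B ∣ * symbolCost + 1 + 1) (Answers (Force 0 B))
                   (regs n w w (∣ B ∣ + n) (M (∣ B ∣ + n)) i τ , M)
    wp-answer {i} {τ} {M = M₀} (table , untouched , _) =
      subst (λ b → WP (evaluate L) (∣ B ∣ * symbolCost + 1) Q₀ (regs n w w b (M₀ b) i τ , M₀)) (ℕ.+-comm n ∣ B ∣)
        (eval B spellsB (ℕ.≤-reflexive (cong suc (ℕ.+-comm n ∣ B ∣))) ℕ.≤-refl (λ _ _ → refl)
          (λ {i} {τ} {M} (bits , _) → wp-exit (≡.trans (cong (_== sym ⊢) (≡.trans (below n (s≤s (ℕ.m≤n+m n ∣ B ∣))) M₁-⊢)) refl)
             (i , τ , M , _ , _ , _ , refl , bits)))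
      then λ { (i , τ , M , p , b , x , refl , bits) → answer (bits 0 z≤n) }
      where
      below : ∀ j → j < w → M₀ j ≡ M₁ j
      below j j<w = untouched j (ℕ.<-≤-trans j<w (ℕ.m≤m+n w 0))
      M₁-⊢ : M₁ n ≡ sym ⊢
      M₁-⊢ = ≡.trans (cong M₁ (≡.sym (ℕ.+-identityʳ n))) (M₁-B {0} refl)
      symAt : ∀ {k c} → nth (cells A 0 0) k ≡ just c → M₀ k ≡ sym (proj₁ c)
      symAt {k} {c} e = ≡.trans (below k (ℕ.<-≤-trans (nth⇒< (word A) {k} e′) n≤w)) (M₁-A {k} e′)
        where
        e′ : nth (word A) k ≡ just (proj₁ c)
        e′ = subst (λ ss → nth ss k ≡ _) (word-cells A 0 0) (nth-map proj₁ (cells A 0 0) {k} e)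
      parAt : ∀ {k c} → nth (cells A 0 0) k ≡ just c → M₀ (w + k) ≡ num (proj₁ (proj₂ c))
      parAt {k} e = AllAt-nth (cells A 0 0) table k e
      open Eval L A w M₀ symAt parAt n≤w using (Bits; eval)
      spellsB : Spells M₀ (suc n) (word B)
      spellsB = spells λ k e → ≡.trans
        (below (suc n + k) (s≤s (subst (_< ∣ B ∣ + n) (ℕ.+-comm k n) (ℕ.+-monoˡ-< n (nth⇒< (word B) {k} e)))))
        (≡.trans (cong M₁ (≡.sym (ℕ.+-suc n k))) (M₁-B {suc k} e))
      Q₀ : Store → Set
      Q₀ σ = ∃[ i ] ∃[ τ ] ∃[ M ] ∃[ p ] ∃[ b ] ∃[ x ] σ ≡ (regs n w p b x i τ , M) × Bits M p (λ j → Force j B)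
      answer : ∀ {i τ M p b x} → ∃[ c ] M (p + 0) ≡ num (bit c) × Reflects (Force 0 B) c →
               WP (block (load 15 6 ∷ []) ⨾ skip) 1 (Answers (Force 0 B)) (regs n w p b x i τ , M)
      -- The root is world 0, so its bit is the first cell of the vector, at address `p` itself.
      answer {M = M} {p} (c , e , r) = wp-load (≡.trans (cong M (≡.sym (ℕ.+-identityʳ p))) e) (wp-block (c , bit-≡ᵇ1 c , r))
        where
        bit-≡ᵇ1 : ∀ c → (bit c ≡ᵇ 1) ≡ c
        bit-≡ᵇ1 true  = refl
        bit-≡ᵇ1 false = refl

    wp-main : WP (main L) (9 + (n * 4 + 1 + (2 + (suc ∣ B ∣ * 4 + 1 + 4))) + (n * visitCost + 1 + (1 + (1 + (∣ B ∣ * symbolCost + 1 + 1)))))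
                 (Answers (Force 0 B)) ([] , M₁)
    wp-main = wp-setup then≡ (wp-parents refl then λ { (τ , M , refl , v) → wp-⨾ (wp-load refl (wp-answer v)) })

    program-decides : ∃[ b ] ∃[ t ] program L ▹ initial A B ⇓ b [ t ] × t ≤ 211 * (n * ∣ B ∣) × Reflects (Force 0 B) b
    program-decides =
      let b , t , run , t≤ , r = run-decider (main L) wp-main
      in b , t , run , ℕ.≤-trans t≤ bound , r
      where
      pos : ∀ C → 1 ≤ ∣ C ∣
      pos (var _)   = s≤s z≤n
      pos ⊤         = s≤s z≤n
      pos (_ ∧ _)   = s≤s z≤n
      pos (⟨ _ ⟩ _) = s≤s z≤n
      bound : 9 + (n * 4 + 1 + (2 + (suc ∣ B ∣ * 4 + 1 + 4))) + (n * visitCost + 1 + (1 + (1 + (∣ B ∣ * symbolCost + 1 + 1)))) + 2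
              ≤ 211 * (n * ∣ B ∣)
      -- Both words are nonempty, so each monomial is at most n * ∣ B ∣, and 28 + 19 + 84 + 80 =
      -- 211.
      bound = begin
        9 + (n * 4 + 1 + (2 + (suc ∣ B ∣ * 4 + 1 + 4))) + (n * visitCost + 1 + (1 + (1 + (∣ B ∣ * symbolCost + 1 + 1)))) + 2
          ≡⟨ solve 2 (λ n b → con 9 :+ (n :* con 4 :+ con 1 :+ (con 2 :+ ((con 1 :+ b) :* con 4 :+ con 1 :+ con 4))) :+
                              (n :* con 15 :+ con 1 :+ (con 1 :+ (con 1 :+ (b :* (con 80 :* (con 1 :+ n)) :+ con 1 :+ con 1)))) :+ con 2
                           := con 28 :* (con 1 :* con 1) :+ con 19 :* (n :* con 1) :+ con 84 :* (con 1 :* b) :+ con 80 :* (n :* b))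
                     refl n ∣ B ∣ ⟩
        28 * (1 * 1) + 19 * (n * 1) + 84 * (1 * ∣ B ∣) + 80 * (n * ∣ B ∣)
          ≤⟨ ℕ.+-monoˡ-≤ (80 * (n * ∣ B ∣)) (ℕ.+-mono-≤ (ℕ.+-mono-≤
               (ℕ.*-monoʳ-≤ 28 (ℕ.*-mono-≤ (pos A) (pos B)))
               (ℕ.*-monoʳ-≤ 19 (ℕ.*-monoʳ-≤ n (pos B))))
               (ℕ.*-monoʳ-≤ 84 (ℕ.*-monoˡ-≤ ∣ B ∣ (pos A)))) ⟩
        28 * (n * ∣ B ∣) + 19 * (n * ∣ B ∣) + 84 * (n * ∣ B ∣) + 80 * (n * ∣ B ∣)
          ≡⟨ solve 1 (λ m → con 28 :* m :+ con 19 :* m :+ con 84 :* m :+ con 80 :* m := con 211 :* m) refl (n * ∣ B ∣) ⟩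
        211 * (n * ∣ B ∣) ∎
        where open ℕ.≤-Reasoning

-- Instances for RJ and RC, and the stated bounds

Axioms : Logic → Rel Formula 0ℓ
Axioms RJ = Never
Axioms RC = Monotonicity

Hit-sound : ∀ L {β δ C} → Hit L β δ → RJ+ (Axioms L) (⟨ δ ⟩ C) (⟨ β ⟩ C)
Hit-sound RJ refl = id
Hit-sound RC β≤δ with ≤ᵐ⇒<ᵐ⊎≡ β≤δ
... | inj₁ β<δ  = axiom (mono β<δ)
... | inj₂ refl = id

module _ (A : Formula) where

  Acc-transʳ : ∀ L → let open Semantics (Hit L) (Hit⇒≤ L) A in
               ∀ {α β x y z} → β ≤ᵐ α → Acc β x y → Acc α y z → Acc β x z
  Acc-transʳ RJ = Semantics.Acc-transʳ-exact _≡_ (Hit⇒≤ RJ) A (λ { refl → <ᵐ-irrefl })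
  Acc-transʳ RC = Semantics.Acc-transʳ-mono _≤ᵐ_ (Hit⇒≤ RC) A ≤ᵐ-trans

  Axioms-sound : ∀ L → let open Semantics (Hit L) (Hit⇒≤ L) A in
                 ∀ {C D x} → Axioms L C D → Force x C → Force x D
  Axioms-sound RC (mono β<α) (y , (z , p , (u , δ , v , q , h , e , r)) , f) =
    y , (z , weaken (≤ᵐ-<ᵐ-trans β≤α) p , (u , δ , v , weaken (≤ᵐ-trans β≤α) q , ≤ᵐ-trans β≤α h , e , weaken (≤ᵐ-trans β≤α) r)) , f
    where
    open Semantics _≤ᵐ_ (Hit⇒≤ RC) A
    β≤α = <ᵐ⇒≤ᵐ β<α

decidable : ∀ L → DecidableInTimeO (λ A B → ∣ A ∣ * ∣ B ∣) (RJ+ (Axioms L))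
decidable L = program L , 211 , λ A B →
  let open Semantics (Hit L) (Hit⇒≤ L) A
      b , t , run , t≤ , r = Input.program-decides A B L
  in b , t , run , t≤ , reflects-map
       (Completeness.complete (Axioms L) (Hit-sound L))
       (λ d → Soundness.sound (Axioms L) (Axioms-sound A L) (Acc-transʳ A L) d (Force-Occ A (Hit-refl L) here)) r

relax : ∀ {f g R} → (∀ A B → f A B ≤ g A B) → DecidableInTimeO f R → DecidableInTimeO g R
relax f≤g (P , C , d) = P , C , λ A B →
  let b , t , run , t≤ , r = d A B in b , t , run , ℕ.≤-trans t≤ (ℕ.*-monoʳ-≤ C (f≤g A B)) , r

*≤^2* : ∀ m n → m * n ≤ m ^ 2 * n
*≤^2* zero        n = z≤n
*≤^2* m@(suc _)   n = ℕ.*-monoˡ-≤ n (subst (_≤ m ^ 2) (ℕ.*-identityʳ m) (ℕ.*-monoʳ-≤ m (s≤s z≤n)))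

^2*≤^3 : ∀ m n → m ^ 2 * n ≤ (m + n) ^ 3
^2*≤^3 m n = subst (m ^ 2 * n ≤_) (ℕ.*-comm ((m + n) ^ 2) (m + n)) (ℕ.*-mono-≤ (ℕ.^-monoˡ-≤ 2 (ℕ.m≤m+n m n)) (ℕ.m≤n+m n m))

^3≤^4 : ∀ m → m ^ 3 ≤ m ^ 4
^3≤^4 zero      = z≤n
^3≤^4 m@(suc _) = ℕ.m≤n*m (m ^ 3) m

theorem5p4 : DecidableInTimeO (λ A B → (∣ A ∣ + ∣ B ∣) ^ 3) _⊢RJ_
    × DecidableInTimeO (λ A B → (∣ A ∣ + ∣ B ∣) ^ 4) _⊢RC_
    × DecidableInTimeO (λ A B → ∣ A ∣ ^ 2 * n[ A , B ] * ∣ B ∣) _⊢RC_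
    × DecidableInTimeO (λ A B → ∣ A ∣ ^ 2 * ∣ B ∣) _⊢RJ_
theorem5p4 =
  relax (λ A B → ℕ.≤-trans (*≤^2* ∣ A ∣ ∣ B ∣) (^2*≤^3 ∣ A ∣ ∣ B ∣)) (decidable RJ) ,
  relax (λ A B → ℕ.≤-trans (*≤^2* ∣ A ∣ ∣ B ∣) (ℕ.≤-trans (^2*≤^3 ∣ A ∣ ∣ B ∣) (^3≤^4 (∣ A ∣ + ∣ B ∣)))) (decidable RC) ,
  -- The maximum in `n[ A , B ]` makes this factor at least 1, so it may be inserted.
  relax (λ A B → ℕ.≤-trans (*≤^2* ∣ A ∣ ∣ B ∣) (ℕ.*-monoˡ-≤ ∣ B ∣
           (subst (_≤ ∣ A ∣ ^ 2 * n[ A , B ]) (ℕ.*-identityʳ (∣ A ∣ ^ 2)) (ℕ.*-monoʳ-≤ (∣ A ∣ ^ 2) (ℕ.m≤n⊔m (length (ℓ (A ∷ B ∷ []))) 1)))))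
        (decidable RC) ,
  relax (λ A B → *≤^2* ∣ A ∣ ∣ B ∣) (decidable RJ)
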